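{- Let $\bar a=(a_1,\dots,a_s)$ be a composition of $n$, let $l$ be a non-negative integer with $2l\le \min_{i\in[s]} a_i$, and let $t$ be a positive integer. Then the complementary sections $\mathrm{CL}^t(\bar a,l)$ and $\mathrm{CL}^{n-t}(\bar a,l)$ of the chainlink polytope have the same Ehrhart quasi-polynomial: $$\operatorname{Ehr}\,\mathrm{CL}^t(\bar a,l)=\operatorname{Ehr}\,\mathrm{CL}^{n-t}(\bar a,l).$$
   Context: A composition of $n$ is a tuple $\bar a=(a_1,\dots,a_s)$ of positive integers with $a_1+\dots+a_s=n$. The chainlink polytope is $$\mathrm{CL}(\bar a,l)=\{x\in\mathbb{R}^s : 0\le x_i\le a_i,\ x_i-x_{i+1}\le a_i-l \text{ for all } i\in[s]\},$$ with indices cyclic modulo $s$ (so $x_{s+1}=x_1$). For real $t$, its section is $\mathrm{CL}^t(\bar a,l)=\mathrm{CL}(\bar a,l)\cap\{x_1+\dots+x_s=t\}$. For a rational polytope $P\subset\mathbb{R}^s$, $\operatorname{Ehr} P$ is the quasi-polynomial function $k\mapsto \#(kP\cap\mathbb{Z}^s)$ of positive integers $k$ (identically $0$ if $P$ is empty). -}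

module Defs where

open import Data.Nat.Base as ℕ using (ℕ; zero; suc; NonZero)
import Data.Nat.Properties as ℕ
open import Data.Nat.DivMod using (_mod_)
open import Data.Integer.Base as ℤ using (ℤ; +_; -[1+_]; +≤+)
import Data.Integer.Properties as ℤ
open import Data.Rational.Base
  using (ℚ; 0ℚ; _/_; _+_; _-_; _*_; _≤_; 1/_; Positive; toℚᵘ)
open import Data.Rational.Properties as ℚ using (_≤?_)
import Data.Rational.Unnormalised.Base as ℚᵘ
import Data.Rational.Unnormalised.Properties as ℚᵘ
open import Data.Fin.Base using (Fin; zero; suc; toℕ)
open import Data.Fin.Properties using (all?)
open import Data.List.Base as List using (List; []; _∷_; length; upTo; cartesianProductWith; filter)
open import Data.List.Membership.Propositional using (_∈_)
open import Data.List.Membership.Propositional.Properties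
  using (∈-cartesianProductWith⁺; ∈-map⁺; ∈-upTo⁺; ∈-filter⁺; ∈-filter⁻)
open import Data.List.Relation.Unary.Any using (here)
open import Data.List.Relation.Unary.All using ([])
open import Data.List.Relation.Unary.Unique.Propositional using (Unique; []; _∷_)
import Data.List.Relation.Unary.Unique.Propositional.Properties as Unique
open import Data.Vec.Base as Vec using (Vec; []; _∷_; lookup; map; foldr′)
open import Data.Vec.Properties using (≡-dec; map-∘; map-id; map-cong; lookup-map; ∷-injective)
open import Data.Vec.Relation.Unary.All using (All)
open import Data.Product using (_×_; _,_; proj₁; proj₂; ∃)
open import Function.Base using (_∘_)
open import Level using (0ℓ)
open import Relation.Nullary.Decidable as Dec using (_×-dec_)
open import Relation.Unary using (Pred; Decidable; _∩_)
open import Relation.Binary.PropositionalEquality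

fromℤ : ℤ → ℚ
fromℤ z = z / 1

fromℕ : ℕ → ℚ
fromℕ n = fromℤ (+ n)

-- A region is a subset of ℚˢ.  A lattice point of a dilate kP of P ⊆ ℝˢ,
-- with k a positive integer, comes from a rational point of P, so the real
-- points of P play no role in the counts below.
Region : ℕ → Set₁
Region s = Pred (Vec ℚ s) 0ℓ

dilate : ∀ {s} → ℕ → Region s → Region s
dilate k P y = ∃ λ x → P x × map (fromℕ k *_) x ≡ y

latticePoints : ∀ {s} → Region s → Pred (Vec ℤ s) 0ℓ
latticePoints P z = P (map fromℤ z)

-- A repetition-free listing of exactly the elements satisfying Q; its
-- length is the cardinality of Q, whichever listing is chosen.
record Enumeration {A : Set} (Q : Pred A 0ℓ) : Set where
  field
    list     : List A
    unique   : Unique list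
    sound    : ∀ {x} → x ∈ list → Q x
    complete : ∀ {x} → Q x → x ∈ list

record LatticeFinite {s} (P : Region s) : Set where
  field
    enumerate : ∀ k .{{_ : NonZero k}} → Enumeration (latticePoints (dilate k P))

Ehr : ∀ {s} (P : Region s) → LatticeFinite P → (k : ℕ) .{{_ : NonZero k}} → ℕ
Ehr P fin k = length (Enumeration.list (LatticeFinite.enumerate fin k))

IsComposition : ∀ {s} → ℕ → Vec ℕ s → Set
IsComposition n a = All (0 ℕ.<_) a × Vec.sum a ≡ n

next : ∀ {s} → Fin s → Fin s
next {suc m} i = suc (toℕ i) mod suc m

CL : ∀ {s} → Vec ℕ s → ℕ → Region s
CL a l x = ∀ i →
  (0ℚ ≤ lookup x i × lookup x i ≤ fromℕ (lookup a i)) ×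
  lookup x i - lookup x (next i) ≤ fromℕ (lookup a i) - fromℕ l

coordinateSum : ∀ {s} → Vec ℚ s → ℚ
coordinateSum = foldr′ _+_ 0ℚ

CLSection : ∀ {s} → Vec ℕ s → ℕ → ℚ → Region s
CLSection a l t = CL a l ∩ (λ x → coordinateSum x ≡ t)

toℚᵘ-fromℤ : ∀ z → toℚᵘ (fromℤ z) ℚᵘ.≃ ℚᵘ.mkℚᵘ z 0
toℚᵘ-fromℤ z = ℚ.toℚᵘ-fromℚᵘ (ℚᵘ.mkℚᵘ z 0)

fromℤ-cancel-≤ : ∀ {z w} → fromℤ z ≤ fromℤ w → z ℤ.≤ w
fromℤ-cancel-≤ {z} {w} p = subst₂ ℤ._≤_ (ℤ.*-identityʳ z) (ℤ.*-identityʳ w)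
  (ℚᵘ.drop-*≤* (ℚᵘ.≤-respˡ-≃ (toℚᵘ-fromℤ z)
    (ℚᵘ.≤-respʳ-≃ (toℚᵘ-fromℤ w) (ℚ.toℚᵘ-mono-≤ p))))

fromℤ-* : ∀ z w → fromℤ z * fromℤ w ≡ fromℤ (z ℤ.* w)
fromℤ-* z w = ℚ.toℚᵘ-injective (ℚᵘ.≃-trans (ℚ.toℚᵘ-homo-* (fromℤ z) (fromℤ w))
  (ℚᵘ.≃-trans (ℚᵘ.*-cong (toℚᵘ-fromℤ z) (toℚᵘ-fromℤ w))
    (ℚᵘ.≃-sym (toℚᵘ-fromℤ (z ℤ.* w)))))

fromℕ-pos : ∀ k .{{_ : NonZero k}} → Positive (fromℕ k)
fromℕ-pos k = ℚ.normalize-pos k 1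

module _ (k : ℕ) .{{_ : NonZero k}} where

  private instance
    k-pos : Positive (fromℕ k)
    k-pos = fromℕ-pos k

    k-nonZero : Data.Rational.Base.NonZero (fromℕ k)
    k-nonZero = ℚ.pos⇒nonZero (fromℕ k)

  unscale : ∀ {s} → Vec ℚ s → Vec ℚ s
  unscale = map (1/ fromℕ k *_)

  unscale-scale : ∀ {s} (x : Vec ℚ s) → unscale (map (fromℕ k *_) x) ≡ x
  unscale-scale x = trans (sym (map-∘ _ _ x)) (trans (map-cong eq x) (map-id x))
    where
    eq : ∀ q → 1/ fromℕ k * (fromℕ k * q) ≡ q
    eq q = trans (sym (ℚ.*-assoc (1/ fromℕ k) (fromℕ k) q))
      (trans (cong (_* q) (ℚ.*-inverseˡ (fromℕ k))) (ℚ.*-identityˡ q))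

  scale-unscale : ∀ {s} (y : Vec ℚ s) → map (fromℕ k *_) (unscale y) ≡ y
  scale-unscale y = trans (sym (map-∘ _ _ y)) (trans (map-cong eq y) (map-id y))
    where
    eq : ∀ q → fromℕ k * (1/ fromℕ k * q) ≡ q
    eq q = trans (sym (ℚ.*-assoc (fromℕ k) (1/ fromℕ k) q))
      (trans (cong (_* q) (ℚ.*-inverseʳ (fromℕ k))) (ℚ.*-identityˡ q))

  dilate? : ∀ {s} {P : Region s} → Decidable P → Decidable (dilate k P)
  dilate? {P = P} P? y = Dec.map′
    (λ p → unscale y , p , scale-unscale y)
    (λ { (x , p , refl) → subst P (sym (unscale-scale x)) p })
    (P? (unscale y))

box : ∀ {s} → ℕ → Vec ℕ s → List (Vec ℤ s)
box k []       = [] ∷ []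
box k (b ∷ bs) = cartesianProductWith _∷_ (List.map +_ (upTo (suc (k ℕ.* b)))) (box k bs)

box-unique : ∀ {s} k (b : Vec ℕ s) → Unique (box k b)
box-unique k []       = [] ∷ []
box-unique k (b ∷ bs) = Unique.cartesianProductWith⁺ _∷_ ∷-injective
  (Unique.map⁺ ℤ.+-injective (Unique.upTo⁺ (suc (k ℕ.* b)))) (box-unique k bs)

box-complete : ∀ {s} k (b : Vec ℕ s) (z : Vec ℤ s) →
  (∀ i → + 0 ℤ.≤ lookup z i × lookup z i ℤ.≤ + (k ℕ.* lookup b i)) → z ∈ box k b
box-complete k []       []             h = here refl
box-complete k (b ∷ bs) (+ m      ∷ z) h = ∈-cartesianProductWith⁺ _∷_
  (∈-map⁺ +_ (∈-upTo⁺ (ℕ.s≤s (ℤ.drop‿+≤+ (proj₂ (h zero))))))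
  (box-complete k bs z (h ∘ suc))
box-complete k (b ∷ bs) (-[1+ m ] ∷ z) h with () ← proj₁ (h zero)

boxed⇒latticeFinite : ∀ {s} {P : Region s} → Decidable P → (b : Vec ℕ s) →
  (∀ {x} → P x → ∀ i → 0ℚ ≤ lookup x i × lookup x i ≤ fromℕ (lookup b i)) →
  LatticeFinite P
boxed⇒latticeFinite {s} {P} P? b bounded = record { enumerate = enum }
  where
  module _ (k : ℕ) .{{_ : NonZero k}} where
    Q? : Decidable (latticePoints (dilate k P))
    Q? z = dilate? k P? (map fromℤ z)

    inBox : ∀ {z} → latticePoints (dilate k P) z →
      ∀ i → + 0 ℤ.≤ lookup z i × lookup z i ℤ.≤ + (k ℕ.* lookup b i)
    inBox {z} (x , p , kx≡z) i =
        fromℤ-cancel-≤ (subst₂ _≤_ (ℚ.*-zeroʳ (fromℕ k)) zᵢ (mono (proj₁ (bounded p i))))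
      , fromℤ-cancel-≤ (subst₂ _≤_ zᵢ kb (mono (proj₂ (bounded p i))))
      where
      mono : ∀ {p q} → p ≤ q → fromℕ k * p ≤ fromℕ k * q
      mono = ℚ.*-monoˡ-≤-nonNeg (fromℕ k)
        {{ℚ.pos⇒nonNeg (fromℕ k) {{fromℕ-pos k}}}}

      zᵢ : fromℕ k * lookup x i ≡ fromℤ (lookup z i)
      zᵢ = trans (sym (lookup-map i _ x)) (trans (cong (λ v → lookup v i) kx≡z) (lookup-map i _ z))

      kb : fromℕ k * fromℕ (lookup b i) ≡ fromℤ (+ (k ℕ.* lookup b i))
      kb = trans (fromℤ-* (+ k) (+ lookup b i)) (cong fromℤ (sym (ℤ.pos-* k (lookup b i))))

    enum : Enumeration (latticePoints (dilate k P))
    enum = record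
      { list     = filter Q? (box k b)
      ; unique   = Unique.filter⁺ Q? (box-unique k b)
      ; sound    = λ z∈ → proj₂ (∈-filter⁻ Q? {xs = box k b} z∈)
      ; complete = λ {z} q → ∈-filter⁺ Q? (box-complete k b z (inBox {z} q)) q
      }

CLSection? : ∀ {s} (a : Vec ℕ s) l t → Decidable (CLSection a l t)
CLSection? a l t x =
  all? (λ i → ((0ℚ ≤? _) ×-dec (_ ≤? _)) ×-dec (_ ≤? _)) ×-dec (coordinateSum x ℚ.≟ t)

CLSection-latticeFinite : ∀ {s} (a : Vec ℕ s) l t → LatticeFinite (CLSection a l t)
CLSection-latticeFinite a l t =
  boxed⇒latticeFinite (CLSection? a l t) a (λ p i → proj₁ (proj₁ p i))

{-# OPTIONS --safe #-}

-- A lattice point x of the dilate k CL lies over the section n − t exactly when Σ (b − x) = k t, where b = k a.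
-- So the claim is that F(q) = Σ q^(Σ x), over the lattice points of k CL, is unchanged when the weight q^x of
-- each coordinate is replaced by q^(b − x).
-- Write each constraint as 1 − [violated].  As 2l ≤ aᵢ, two consecutive constraints are never violated
-- together, so the sum over all x collapses to the trace of a product of 2 × 2 matrices
-- [[Wᵢ, −vᵢ], [1, 0]], where Wᵢ = 1 + q + ⋯ + q^bᵢ and vᵢ = c q^(bᵢ − L) is the total weight of
-- the pairs violating the i-th constraint, with L = k l.
-- For the complementary weight vᵢ is replaced by c q^(bᵢ₊₁ − L).  Both cyclic products are, up to rotation,
-- conjugate under one fixed matrix G, so their traces agree for every integer q ≥ 1.

module Submission where

open import Defs
open import Algebra.Bundles using (CommutativeSemiring)
open import Data.Bool.Base using (if_then_else_)
open import Data.Nat.Base as ℕ using (ℕ; zero; suc; z≤n; s≤s; _∸_; NonZero)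
import Data.Nat.Properties as ℕ
open import Data.Nat.DivMod using (m<n⇒m%n≡m; n%n≡0)
open import Data.Integer.Base as ℤ using (ℤ; +_; 0ℤ; 1ℤ; -1ℤ; _+_; _*_; _-_; -_; _^_; +≤+)
import Data.Integer.Properties as ℤ
open import Data.Integer.Tactic.RingSolver using (solve-∀)
open import Algebra.Properties.Semiring.Sum
  (CommutativeSemiring.semiring ℤ.+-*-commutativeSemiring)
  using (sum; sum-cong-≗; sum-replicate-zero; sum-init-last; ∑-distrib-+; ∑-comm; *-distribˡ-sum)
open import Data.Rational.Base as ℚ using (ℚ)
import Data.Rational.Properties as ℚ
import Data.Rational.Unnormalised.Base as ℚᵘ
import Data.Rational.Unnormalised.Properties as ℚᵘ
open import Data.Fin.Base as Fin using (Fin; zero; suc; toℕ; inject₁)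
import Data.Fin.Properties as Fin
open import Data.Fin.Relation.Unary.Top using (view; ‵fromℕ; ‵inject₁)
open import Data.List.Base as List using (length; filter; cartesianProductWith; applyUpTo)
import Data.List.Properties as List
open import Data.Product using (_×_; _,_; proj₂)
open import Data.Vec.Base as Vec using (Vec; []; _∷_; _∷ʳ_; lookup; map)
open import Data.Vec.Properties using (lookup-map)
open import Data.Vec.Relation.Unary.All using (All; []; _∷_)
import Data.Vec.Relation.Unary.All.Properties as All
open import Data.Vec.Relation.Binary.Pointwise.Inductive as Pointwise using (Pointwise; []; _∷_)
open import Function.Base using (_∘_)
open import Relation.Nullary using (Dec; yes; no; does; ¬_; contradiction; _×-dec_)
open import Relation.Nullary.Decidable using (dec-true; dec-false)
open import Relation.Unary using (Decidable)
open import Relation.Binary.PropositionalEquality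
open ≡-Reasoning

-- Finite sums over initial segments of the naturals

∑ : ℕ → (ℕ → ℤ) → ℤ
∑ n f = sum {n} (f ∘ toℕ)

∑-cong : ∀ n {f g} → (∀ x → x ℕ.< n → f x ≡ g x) → ∑ n f ≡ ∑ n g
∑-cong n h = sum-cong-≗ {n} (λ i → h (toℕ i) (Fin.toℕ<n i))

∑-zero : ∀ n {f} → (∀ x → x ℕ.< n → f x ≡ 0ℤ) → ∑ n f ≡ 0ℤ
∑-zero n h = trans (∑-cong n h) (sum-replicate-zero n)

∑-*ˡ : ∀ n c f → ∑ n (λ x → c * f x) ≡ c * ∑ n f
∑-*ˡ n c f = sym (*-distribˡ-sum {n} c (f ∘ toℕ))

∑-linear : ∀ n c d f g → ∑ n (λ x → c * f x + d * g x) ≡ c * ∑ n f + d * ∑ n g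
∑-linear n c d f g = trans (∑-distrib-+ {n} (λ i → c * f (toℕ i)) (λ i → d * g (toℕ i)))
  (cong₂ _+_ (∑-*ˡ n c f) (∑-*ˡ n d g))

∑-swap : ∀ m n (f : ℕ → ℕ → ℤ) → ∑ m (λ x → ∑ n (f x)) ≡ ∑ n (λ y → ∑ m (λ x → f x y))
∑-swap m n f = ∑-comm {m} {n} (λ i j → f (toℕ i) (toℕ j))

∑-last : ∀ n f → ∑ (suc n) f ≡ ∑ n f + f n
∑-last n f = trans (sum-init-last {n} (f ∘ toℕ))
  (cong₂ _+_ (sum-cong-≗ {n} (λ i → cong f (Fin.toℕ-inject₁ i))) (cong f (Fin.toℕ-fromℕ n)))

∑-reflect : ∀ n f → ∑ (suc n) f ≡ ∑ (suc n) (λ x → f (n ∸ x))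
∑-reflect zero    f = refl
∑-reflect (suc n) f = begin
  ∑ (suc (suc n)) f                              ≡⟨ ∑-last (suc n) f ⟩
  ∑ (suc n) f + f (suc n)                        ≡⟨ ℤ.+-comm _ (f (suc n)) ⟩
  f (suc n) + ∑ (suc n) f                        ≡⟨ cong (_+_ (f (suc n))) (∑-reflect n f) ⟩
  f (suc n) + ∑ (suc n) (λ x → f (n ∸ x))        ∎

∑-truncate : ∀ {m n} f → n ℕ.≤ m → (∀ x → n ℕ.≤ x → f x ≡ 0ℤ) → ∑ m f ≡ ∑ n f
∑-truncate {m} f z≤n       h = ∑-zero m (λ x _ → h x z≤n)
∑-truncate     f (s≤s n≤m) h =
  cong (_+_ (f 0)) (∑-truncate (f ∘ suc) n≤m (λ x n≤x → h (suc x) (s≤s n≤x)))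

∑-nonneg : ∀ n f → (∀ x → 0ℤ ℤ.≤ f x) → 0ℤ ℤ.≤ ∑ n f
∑-nonneg zero    f h = ℤ.≤-refl
∑-nonneg (suc n) f h = ℤ.+-mono-≤ (h 0) (∑-nonneg n (f ∘ suc) (h ∘ suc))

-- Integer indicators of decidable propositions

⟦_⟧ : ∀ {p} {P : Set p} → Dec P → ℤ
⟦ P? ⟧ = if does P? then 1ℤ else 0ℤ

⟦⟧-true : ∀ {p} {P : Set p} (P? : Dec P) → P → ⟦ P? ⟧ ≡ 1ℤ
⟦⟧-true P? p = cong (if_then 1ℤ else 0ℤ) (dec-true P? p)

⟦⟧-false : ∀ {p} {P : Set p} (P? : Dec P) → ¬ P → ⟦ P? ⟧ ≡ 0ℤ
⟦⟧-false P? ¬p = cong (if_then 1ℤ else 0ℤ) (dec-false P? ¬p)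

⟦⟧-cong : ∀ {p q} {P : Set p} {Q : Set q} (P? : Dec P) (Q? : Dec Q) →
  (P → Q) → (Q → P) → ⟦ P? ⟧ ≡ ⟦ Q? ⟧
⟦⟧-cong P? (yes q) f g = ⟦⟧-true P? (g q)
⟦⟧-cong P? (no ¬q) f g = ⟦⟧-false P? (¬q ∘ f)

⟦⟧-nonneg : ∀ {p} {P : Set p} (P? : Dec P) → 0ℤ ℤ.≤ ⟦ P? ⟧
⟦⟧-nonneg (yes _) = +≤+ z≤n
⟦⟧-nonneg (no _)  = +≤+ z≤n

-- Sums over the integer points of a box

boxSum : ∀ {n} → Vec ℕ n → (Vec ℕ n → ℤ) → ℤ
boxSum []       f = f []
boxSum (b ∷ bs) f = ∑ (suc b) (λ x → boxSum bs (λ xs → f (x ∷ xs)))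

boxSum-cong : ∀ {n} (bs : Vec ℕ n) {f g} →
  (∀ xs → Pointwise ℕ._≤_ xs bs → f xs ≡ g xs) → boxSum bs f ≡ boxSum bs g
boxSum-cong []       h = h [] []
boxSum-cong (b ∷ bs) h = ∑-cong (suc b) λ x x≤b →
  boxSum-cong bs λ xs p → h (x ∷ xs) (ℕ.≤-pred x≤b ∷ p)

boxSum-*ˡ : ∀ {n} (bs : Vec ℕ n) c f → boxSum bs (λ xs → c * f xs) ≡ c * boxSum bs f
boxSum-*ˡ []       c f = refl
boxSum-*ˡ (b ∷ bs) c f = trans
  (∑-cong (suc b) (λ x _ → boxSum-*ˡ bs c (λ xs → f (x ∷ xs))))
  (∑-*ˡ (suc b) c (λ x → boxSum bs (λ xs → f (x ∷ xs))))

boxSum-∑ : ∀ {n} (bs : Vec ℕ n) m (f : Vec ℕ n → ℕ → ℤ) →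
  boxSum bs (λ xs → ∑ m (f xs)) ≡ ∑ m (λ j → boxSum bs (λ xs → f xs j))
boxSum-∑ []       m f = refl
boxSum-∑ (b ∷ bs) m f = trans
  (∑-cong (suc b) (λ x _ → boxSum-∑ bs m (λ xs → f (x ∷ xs))))
  (∑-swap (suc b) m (λ x j → boxSum bs (λ xs → f (x ∷ xs) j)))

-- Two-by-two matrices and cyclic products

record Matrix : Set where
  constructor matrix
  field m₁₁ m₁₂ m₂₁ m₂₂ : ℤ

open Matrix

matrix-≡ : ∀ {a b c d a′ b′ c′ d′} → a ≡ a′ → b ≡ b′ → c ≡ c′ → d ≡ d′ →
  matrix a b c d ≡ matrix a′ b′ c′ d′
matrix-≡ refl refl refl refl = refl

infixl 7 _⊗_

_⊗_ : Matrix → Matrix → Matrix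
matrix a b c d ⊗ matrix a′ b′ c′ d′ =
  matrix (a * a′ + b * c′) (a * b′ + b * d′) (c * a′ + d * c′) (c * b′ + d * d′)

⊗-assoc : ∀ M N O → (M ⊗ N) ⊗ O ≡ M ⊗ (N ⊗ O)
⊗-assoc (matrix a b c d) (matrix a′ b′ c′ d′) (matrix x y z w) =
  matrix-≡ (eq a b a′ b′ c′ d′ x z) (eq a b a′ b′ c′ d′ y w)
           (eq c d a′ b′ c′ d′ x z) (eq c d a′ b′ c′ d′ y w)
  where
  eq : ∀ a b a′ b′ c′ d′ x z →
    (a * a′ + b * c′) * x + (a * b′ + b * d′) * z ≡ a * (a′ * x + b′ * z) + b * (c′ * x + d′ * z)
  eq = solve-∀

trace det : Matrix → ℤ
trace (matrix a b c d) = a + d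
det   (matrix a b c d) = a * d - b * c

adjugate : Matrix → Matrix
adjugate (matrix a b c d) = matrix d (- b) (- c) a

-- Similar matrices have equal traces. The adjugate stands in for the inverse of `G`, which need not
-- exist over the integers, at the price of the factor `det G`.
intertwined⇒trace : ∀ G M N → G ⊗ M ≡ N ⊗ G → det G * trace M ≡ det G * trace N
intertwined⇒trace G M N GM≡NG = begin
  det G * trace M                ≡⟨ eq₁ (m₁₁ G) (m₁₂ G) (m₂₁ G) (m₂₂ G) (m₁₁ M) (m₁₂ M) (m₂₁ M) (m₂₂ M) ⟨
  trace (adjugate G ⊗ (G ⊗ M))   ≡⟨ cong (λ X → trace (adjugate G ⊗ X)) GM≡NG ⟩
  trace (adjugate G ⊗ (N ⊗ G))   ≡⟨ eq₂ (m₁₁ G) (m₁₂ G) (m₂₁ G) (m₂₂ G) (m₁₁ N) (m₁₂ N) (m₂₁ N) (m₂₂ N) ⟩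
  det G * trace N                ∎
  where
  eq₁ : ∀ a b c d x y z w →
    (d * (a * x + b * z) + - b * (c * x + d * z)) + (- c * (a * y + b * w) + a * (c * y + d * w))
      ≡ (a * d - b * c) * (x + w)
  eq₁ = solve-∀
  eq₂ : ∀ a b c d x y z w →
    (d * (x * a + y * c) + - b * (z * a + w * c)) + (- c * (x * b + y * d) + a * (z * b + w * d))
      ≡ (a * d - b * c) * (x + w)
  eq₂ = solve-∀

lastFrom : ∀ {n} → ℕ → Vec ℕ n → ℕ
lastFrom b []        = b
lastFrom b (b′ ∷ bs) = lastFrom b′ bs

lastFrom⁺ : ∀ {n ℓ} {R : ℕ → Set ℓ} {b} {bs : Vec ℕ n} → R b → All R bs → R (lastFrom b bs)
lastFrom⁺ r []       = r
lastFrom⁺ _ (r ∷ rs) = lastFrom⁺ r rs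

-- The final factor lacks the weight of the edge that closes the cycle.
openProduct : ∀ {n} → (ℕ → ℤ) → (ℕ → ℕ → ℤ) → ℕ → Vec ℕ n → Matrix
openProduct W v b []        = matrix (W b) 1ℤ 1ℤ 0ℤ
openProduct W v b (b′ ∷ bs) = matrix (W b) (- v b b′) 1ℤ 0ℤ ⊗ openProduct W v b′ bs

-- With `u` the weight of the edge from the last vertex back to the first, this is the trace of
-- `P ⊗ matrix 1ℤ 0ℤ 0ℤ (- u)`. The diagonal factor puts the missing weight into the final matrix
-- and thereby closes the cycle.
cyclicTrace : ∀ {n} → (ℕ → ℤ) → (ℕ → ℕ → ℤ) → ℕ → Vec ℕ n → ℤ
cyclicTrace W v b bs = m₁₁ P - v (lastFrom b bs) b * m₂₂ P
  where P = openProduct W v b bs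

-- The predicate `R` is there because the closed forms of the edge weights hold only between
-- vertices with large bounds.
cyclicTrace-cong : ∀ {n} {ℓ} {R : ℕ → Set ℓ} {W W′ : ℕ → ℤ} {v v′ : ℕ → ℕ → ℤ} →
  (∀ b → W b ≡ W′ b) → (∀ {b b′} → R b → R b′ → v b b′ ≡ v′ b b′) →
  ∀ {b} {bs : Vec ℕ n} → R b → All R bs → cyclicTrace W v b bs ≡ cyclicTrace W′ v′ b bs
cyclicTrace-cong {R = R} {W} {W′} {v} {v′} W≡ v≡ {b} {bs} r rs =
  cong₂ (λ P w → m₁₁ P - w * m₂₂ P) (product r rs) (v≡ (lastFrom⁺ r rs) r)
  where
  product : ∀ {n b} {bs : Vec ℕ n} → R b → All R bs → openProduct W v b bs ≡ openProduct W′ v′ b bs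
  product {b = b} {[]}      r []        = cong (λ w → matrix w 1ℤ 1ℤ 0ℤ) (W≡ b)
  product {b = b} {b′ ∷ bs} r (r′ ∷ rs) =
    cong₂ _⊗_ (cong₂ (λ w u → matrix w (- u) 1ℤ 0ℤ) (W≡ b) (v≡ r r′)) (product r′ rs)

-- The abstract form of the conjugation. It is applied with `p` = q - 1, `A` = q^(L + 1), `Q b` =
-- q^(b - L), and `c` the part of the violation weight that does not depend on the bounds.
module Reversal (W Q : ℕ → ℤ) (p A c : ℤ) where

  forward backward : ℕ → ℕ → ℤ
  forward  b b′ = c * Q b
  backward b b′ = c * Q b′

  -- A forward weight depends only on the source, so it fits into the source's factor `M b`. A
  -- backward weight `c * Q b′` is split: `- c` stays with the source, and `Q b′` goes to the lower
  -- row of the target's factor. Each factor then involves a single bound.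
  M N : ℕ → Matrix
  M b = matrix (W b) (- (c * Q b)) 1ℤ 0ℤ
  N b = matrix (W b) (- c) (Q b) 0ℤ

  ∏ : ∀ {n} → (ℕ → Matrix) → ℕ → Vec ℕ n → Matrix
  ∏ X b []        = X b
  ∏ X b (b′ ∷ bs) = X b ⊗ ∏ X b′ bs

  forward-product : ∀ {n} b (bs : Vec ℕ n) → ∏ M b bs ≡
    openProduct W forward b bs ⊗ matrix 1ℤ 0ℤ 0ℤ (- (c * Q (lastFrom b bs)))
  forward-product b [] = matrix-≡ (e₁ (W b)) (e₂ (W b) (c * Q b)) refl (e₃ (c * Q b))
    where
    e₁ : ∀ w → w ≡ w * 1ℤ + 1ℤ * 0ℤ
    e₁ = solve-∀
    e₂ : ∀ w x → - x ≡ w * 0ℤ + 1ℤ * - x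
    e₂ = solve-∀
    e₃ : ∀ x → 0ℤ ≡ 1ℤ * 0ℤ + 0ℤ * - x
    e₃ = solve-∀
  forward-product b (b′ ∷ bs) =
    trans (cong (M b ⊗_) (forward-product b′ bs)) (sym (⊗-assoc (M b) _ _))

  -- The diagonal matrices diag(1, `Q`) telescope: the one of the next vertex, absorbed from the
  -- right by `N b`, restores the ordinary factor with weight `c * Q b′` and leaves the diagonal
  -- matrix of `b` on the left. The outer two close the cycle under the trace.
  backward-product : ∀ {n} b (bs : Vec ℕ n) → ∏ N b bs ≡
    matrix 1ℤ 0ℤ 0ℤ (Q b) ⊗ openProduct W backward b bs ⊗ matrix 1ℤ 0ℤ 0ℤ (- c)
  backward-product b [] = matrix-≡ (e₁ (W b)) (e₂ (W b) c) (e₃ (Q b)) (e₄ (Q b) c)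
    where
    e₁ : ∀ w → w ≡ (1ℤ * w + 0ℤ * 1ℤ) * 1ℤ + (1ℤ * 1ℤ + 0ℤ * 0ℤ) * 0ℤ
    e₁ = solve-∀
    e₂ : ∀ w c → - c ≡ (1ℤ * w + 0ℤ * 1ℤ) * 0ℤ + (1ℤ * 1ℤ + 0ℤ * 0ℤ) * - c
    e₂ = solve-∀
    e₃ : ∀ q → q ≡ (0ℤ + q * 1ℤ) * 1ℤ + (0ℤ + q * 0ℤ) * 0ℤ
    e₃ = solve-∀
    e₄ : ∀ q c → 0ℤ ≡ (0ℤ + q * 1ℤ) * 0ℤ + (0ℤ + q * 0ℤ) * - c
    e₄ = solve-∀
  backward-product b (b′ ∷ bs) = begin
    N b ⊗ ∏ N b′ bs                 ≡⟨ cong (N b ⊗_) (trans (backward-product b′ bs) (⊗-assoc D′ P E)) ⟩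
    N b ⊗ (D′ ⊗ (P ⊗ E))            ≡⟨ ⊗-assoc (N b) D′ (P ⊗ E) ⟨
    N b ⊗ D′ ⊗ (P ⊗ E)              ≡⟨ cong (_⊗ (P ⊗ E)) (step (W b) (Q b) (Q b′) c) ⟩
    D ⊗ X ⊗ (P ⊗ E)                 ≡⟨ ⊗-assoc (D ⊗ X) P E ⟨
    D ⊗ X ⊗ P ⊗ E                   ≡⟨ cong (_⊗ E) (⊗-assoc D X P) ⟩
    D ⊗ (X ⊗ P) ⊗ E                 ∎
    where
    D  = matrix 1ℤ 0ℤ 0ℤ (Q b)
    D′ = matrix 1ℤ 0ℤ 0ℤ (Q b′)
    E  = matrix 1ℤ 0ℤ 0ℤ (- c)
    X  = matrix (W b) (- (c * Q b′)) 1ℤ 0ℤ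
    P  = openProduct W backward b′ bs

    step : ∀ w q q′ c → matrix w (- c) q 0ℤ ⊗ matrix 1ℤ 0ℤ 0ℤ q′ ≡
      matrix 1ℤ 0ℤ 0ℤ q ⊗ matrix w (- (c * q′)) 1ℤ 0ℤ
    step w q q′ c = matrix-≡ (e₁ w c) (e₂ w c q′) (e₃ q) (e₄ q q′ c)
      where
      e₁ : ∀ w c → w * 1ℤ + - c * 0ℤ ≡ 1ℤ * w + 0ℤ * 1ℤ
      e₁ = solve-∀
      e₂ : ∀ w c q′ → w * 0ℤ + - c * q′ ≡ 1ℤ * - (c * q′) + 0ℤ * 0ℤ
      e₂ = solve-∀
      e₃ : ∀ q → q * 1ℤ + 0ℤ * 0ℤ ≡ 0ℤ + q * 1ℤ
      e₃ = solve-∀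
      e₄ : ∀ q q′ c → q * 0ℤ + 0ℤ * q′ ≡ 0ℤ * - (c * q′) + q * 0ℤ
      e₄ = solve-∀

  trace-forward : ∀ {n} b (bs : Vec ℕ n) → trace (∏ M b bs) ≡ cyclicTrace W forward b bs
  trace-forward b bs = trans (cong trace (forward-product b bs))
    (eq (m₁₁ P) (m₁₂ P) (m₂₁ P) (m₂₂ P) (c * Q (lastFrom b bs)))
    where
    P = openProduct W forward b bs
    eq : ∀ x y z w u → (x * 1ℤ + y * 0ℤ) + (z * 0ℤ + w * - u) ≡ x - u * w
    eq = solve-∀

  trace-backward : ∀ {n} b (bs : Vec ℕ n) → trace (∏ N b bs) ≡ cyclicTrace W backward b bs
  trace-backward b bs = trans (cong trace (backward-product b bs))
    (eq (m₁₁ P) (m₁₂ P) (m₂₁ P) (m₂₂ P) (Q b) c)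
    where
    P = openProduct W backward b bs
    eq : ∀ x y z w q c →
      ((1ℤ * x + 0ℤ * z) * 1ℤ + (1ℤ * y + 0ℤ * w) * 0ℤ) + ((0ℤ * x + q * z) * 0ℤ + (0ℤ * y + q * w) * - c)
        ≡ x - c * q * w
    eq = solve-∀

  -- The conjugating matrix. It contains no bound `b`, so the same `G` can be passed through every
  -- factor of the product.
  G : Matrix
  G = matrix A (- (p * c)) p 1ℤ

  module _ {ℓ} {R : ℕ → Set ℓ} (pW+1≡AQ : ∀ {b} → R b → p * W b + 1ℤ ≡ A * Q b) where

    -- The diagonal entries agree identically. Each off-diagonal entry reduces to the relation
    -- between `W b` and `Q b`, which in the application is the geometric series.
    intertwines-factor : ∀ {b} → R b → G ⊗ M b ≡ N b ⊗ G
    intertwines-factor {b} r = matrix-≡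
      (e₁ A (W b) p c)
      (trans (e₂ A (Q b) p c) (trans (cong (λ x → - (c * x)) (sym (pW+1≡AQ r))) (e₃ (W b) p c)))
      (trans (e₄ p (W b)) (trans (pW+1≡AQ r) (e₅ A (Q b) p)))
      (e₆ (Q b) p c)
      where
      e₁ : ∀ A w p c → A * w + - (p * c) * 1ℤ ≡ w * A + - c * p
      e₁ = solve-∀
      e₂ : ∀ A q p c → A * - (c * q) + - (p * c) * 0ℤ ≡ - (c * (A * q))
      e₂ = solve-∀
      e₃ : ∀ w p c → - (c * (p * w + 1ℤ)) ≡ w * - (p * c) + - c * 1ℤ
      e₃ = solve-∀
      e₄ : ∀ p w → p * w + 1ℤ * 1ℤ ≡ p * w + 1ℤ
      e₄ = solve-∀
      e₅ : ∀ A q p → A * q ≡ q * A + 0ℤ * p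
      e₅ = solve-∀
      e₆ : ∀ q p c → p * - (c * q) + 1ℤ * 0ℤ ≡ q * - (p * c) + 0ℤ * 1ℤ
      e₆ = solve-∀

    intertwines : ∀ {n b} {bs : Vec ℕ n} → R b → All R bs → G ⊗ ∏ M b bs ≡ ∏ N b bs ⊗ G
    intertwines {b = b} {[]} r [] = intertwines-factor r
    intertwines {b = b} {b′ ∷ bs} r (r′ ∷ rs) = begin
      G ⊗ (M b ⊗ ∏ M b′ bs)   ≡⟨ ⊗-assoc G (M b) (∏ M b′ bs) ⟨
      G ⊗ M b ⊗ ∏ M b′ bs     ≡⟨ cong (_⊗ ∏ M b′ bs) (intertwines-factor r) ⟩
      N b ⊗ G ⊗ ∏ M b′ bs     ≡⟨ ⊗-assoc (N b) G (∏ M b′ bs) ⟩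
      N b ⊗ (G ⊗ ∏ M b′ bs)   ≡⟨ cong (N b ⊗_) (intertwines r′ rs) ⟩
      N b ⊗ (∏ N b′ bs ⊗ G)   ≡⟨ ⊗-assoc (N b) (∏ N b′ bs) G ⟨
      N b ⊗ ∏ N b′ bs ⊗ G     ∎

    cyclicTrace-reversal : .{{_ : ℤ.NonZero (det G)}} → ∀ {n b} {bs : Vec ℕ n} → R b → All R bs →
      cyclicTrace W forward b bs ≡ cyclicTrace W backward b bs
    cyclicTrace-reversal {b = b} {bs} r rs = begin
      cyclicTrace W forward b bs    ≡⟨ trace-forward b bs ⟨
      trace (∏ M b bs)              ≡⟨ ℤ.*-cancelˡ-≡ (det G) _ _ (intertwined⇒trace G (∏ M b bs) (∏ N b bs) (intertwines r rs)) ⟩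
      trace (∏ N b bs)              ≡⟨ trace-backward b bs ⟩
      cyclicTrace W backward b bs   ∎

-- The transfer matrix of a weighted cycle

module Cycle (L : ℕ) where

  Large : ℕ → Set
  Large b = 2 ℕ.* L ℕ.≤ b

  large⇒L+L≤ : ∀ {b} → Large b → L ℕ.+ L ℕ.≤ b
  large⇒L+L≤ {b} = subst (ℕ._≤ b) (cong (L ℕ.+_) (ℕ.+-identityʳ L))

  -- The constraint x - y ≤ b - L and its negation, with the subtracted terms moved across so that
  -- truncated subtraction does not enter.
  edge violation : ℕ → ℕ → ℕ → ℤ
  edge      b x y = ⟦ L ℕ.+ x ℕ.≤? b ℕ.+ y ⟧
  violation b x y = ⟦ b ℕ.+ y ℕ.<? L ℕ.+ x ⟧

  violation-false : ∀ b x y → L ℕ.+ x ℕ.≤ b ℕ.+ y → violation b x y ≡ 0ℤ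
  violation-false b x y ok = ⟦⟧-false (b ℕ.+ y ℕ.<? L ℕ.+ x) (ℕ.≤⇒≯ ok)

  edge≡1-violation : ∀ b x y → edge b x y ≡ 1ℤ - violation b x y
  edge≡1-violation b x y with L ℕ.+ x ℕ.≤? b ℕ.+ y
  ... | yes ok = trans (⟦⟧-true (L ℕ.+ x ℕ.≤? b ℕ.+ y) ok)
    (sym (cong (_-_ 1ℤ) (violation-false b x y ok)))
  ... | no ¬ok = trans (⟦⟧-false (L ℕ.+ x ℕ.≤? b ℕ.+ y) ¬ok)
    (sym (cong (_-_ 1ℤ) (⟦⟧-true (b ℕ.+ y ℕ.<? L ℕ.+ x) (ℕ.≰⇒> ¬ok))))

  edgeProduct : ∀ {n} → Vec ℕ n → Vec ℕ n → Vec ℕ n → ℤ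
  edgeProduct []       []       []       = 1ℤ
  edgeProduct (b ∷ bs) (x ∷ xs) (y ∷ ys) = edge b x y * edgeProduct bs xs ys

  module Transfer (ω : ℕ → ℕ → ℤ) where

    weight : ∀ {n} → Vec ℕ n → Vec ℕ n → ℤ
    weight []       []       = 1ℤ
    weight (b ∷ bs) (x ∷ xs) = ω b x * weight bs xs

    -- Sum over the paths that start at x and whose last edge leads to z.
    pathSum : ∀ {n} → ℕ → Vec ℕ n → ℕ → ℕ → ℤ
    pathSum b []        z x = ω b x * edge b x z
    pathSum b (b′ ∷ bs) z x = ω b x * ∑ (suc b′) (λ y → edge b x y * pathSum b′ bs z y)

    -- The value 1 on the empty path lets `pathSum-free` hold at the last vertex too, and it is the
    -- initial value of the two-term recurrence below.
    pathTotal : ∀ {n} → Vec ℕ n → ℕ → ℤ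
    pathTotal []       z = 1ℤ
    pathTotal (b ∷ bs) z = ∑ (suc b) (pathSum b bs z)

    boxSum≡pathSum : ∀ {n} b (bs : Vec ℕ n) z x →
      boxSum bs (λ xs → edgeProduct (b ∷ bs) (x ∷ xs) (xs ∷ʳ z) * weight (b ∷ bs) (x ∷ xs)) ≡ pathSum b bs z x
    boxSum≡pathSum b [] z x = eq (ω b x) (edge b x z)
      where
      eq : ∀ w e → (e * 1ℤ) * (w * 1ℤ) ≡ w * e
      eq = solve-∀
    boxSum≡pathSum b (b′ ∷ bs) z x = trans
      (∑-cong (suc b′) λ y _ → begin
        boxSum bs (λ xs → (edge b x y * edgeProduct (b′ ∷ bs) (y ∷ xs) (xs ∷ʳ z)) * (ω b x * weight (b′ ∷ bs) (y ∷ xs)))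
          ≡⟨ boxSum-cong bs (λ xs _ →
             eq (edge b x y) (edgeProduct (b′ ∷ bs) (y ∷ xs) (xs ∷ʳ z)) (ω b x) (weight (b′ ∷ bs) (y ∷ xs))) ⟩
        boxSum bs (λ xs → (ω b x * edge b x y) * (edgeProduct (b′ ∷ bs) (y ∷ xs) (xs ∷ʳ z) * weight (b′ ∷ bs) (y ∷ xs)))
          ≡⟨ boxSum-*ˡ bs (ω b x * edge b x y) (λ xs → edgeProduct (b′ ∷ bs) (y ∷ xs) (xs ∷ʳ z) * weight (b′ ∷ bs) (y ∷ xs)) ⟩
        (ω b x * edge b x y) * boxSum bs (λ xs → edgeProduct (b′ ∷ bs) (y ∷ xs) (xs ∷ʳ z) * weight (b′ ∷ bs) (y ∷ xs))
          ≡⟨ cong ((ω b x * edge b x y) *_) (boxSum≡pathSum b′ bs z y) ⟩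
        (ω b x * edge b x y) * pathSum b′ bs z y
          ≡⟨ ℤ.*-assoc (ω b x) (edge b x y) _ ⟩
        ω b x * (edge b x y * pathSum b′ bs z y) ∎)
      (∑-*ˡ (suc b′) (ω b x) (λ y → edge b x y * pathSum b′ bs z y))
      where
      eq : ∀ e p w u → (e * p) * (w * u) ≡ (w * e) * (p * u)
      eq = solve-∀

    -- If x ≤ b - L, then the edge leaving x holds for every target, so the rest of the path is
    -- summed independently of x.
    pathSum-free : ∀ {n} b (bs : Vec ℕ n) z x → L ℕ.+ x ℕ.≤ b → pathSum b bs z x ≡ ω b x * pathTotal bs z
    pathSum-free b [] z x L+x≤b =
      cong (ω b x *_) (⟦⟧-true (L ℕ.+ x ℕ.≤? b ℕ.+ z) (ℕ.m≤n⇒m≤n+o z L+x≤b))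
    pathSum-free b (b′ ∷ bs) z x L+x≤b = cong (ω b x *_) (∑-cong (suc b′) λ y _ →
      trans (cong (_* pathSum b′ bs z y) (⟦⟧-true (L ℕ.+ x ℕ.≤? b ℕ.+ y) (ℕ.m≤n⇒m≤n+o y L+x≤b)))
        (ℤ.*-identityˡ (pathSum b′ bs z y)))

    W : ℕ → ℤ
    W b = ∑ (suc b) (ω b)

    outViolation : ℕ → ℕ → ℕ → ℤ
    outViolation b b′ x = ∑ (suc b′) (λ y → violation b x y * ω b′ y)

    v : ℕ → ℕ → ℤ
    v b b′ = ∑ (suc b) (λ x → ω b x * outViolation b b′ x)

    -- A violated edge forces its target below L ≤ b′ ∸ L, so the edge leaving the target holds.
    violated⇒free : ∀ {b b′ x y} → Large b′ → x ℕ.≤ b → b ℕ.+ y ℕ.< L ℕ.+ x → L ℕ.+ y ℕ.≤ b′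
    violated⇒free {b} {b′} {x} {y} lb′ x≤b bad =
      ℕ.≤-trans (ℕ.+-monoʳ-≤ L (ℕ.<⇒≤ y<L)) (large⇒L+L≤ lb′)
      where
      y<L : y ℕ.< L
      y<L = ℕ.+-cancelˡ-< x y L (ℕ.<-≤-trans (ℕ.≤-<-trans (ℕ.+-monoˡ-≤ y x≤b) bad) (ℕ.≤-reflexive (ℕ.+-comm L x)))

    -- Write the first edge as 1 - [violated]. In the violated part the target is low, so by
    -- `pathSum-free` the remainder factors as `ω b′ y * pathTotal bs z`. This skips one vertex and
    -- produces the second term.
    pathSum-step : ∀ {n b b′} → Large b′ → (bs : Vec ℕ n) → ∀ z x → x ℕ.≤ b →
      pathSum b (b′ ∷ bs) z x ≡ ω b x * (pathTotal (b′ ∷ bs) z - outViolation b b′ x * pathTotal bs z)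
    pathSum-step {b = b} {b′} lb′ bs z x x≤b = cong (ω b x *_) (begin
      ∑ (suc b′) (λ y → edge b x y * pathSum b′ bs z y)
        ≡⟨ ∑-cong (suc b′) (λ y _ → split y) ⟩
      ∑ (suc b′) (λ y → 1ℤ * pathSum b′ bs z y + - pathTotal bs z * (violation b x y * ω b′ y))
        ≡⟨ ∑-linear (suc b′) 1ℤ (- pathTotal bs z) (pathSum b′ bs z) (λ y → violation b x y * ω b′ y) ⟩
      1ℤ * pathTotal (b′ ∷ bs) z + - pathTotal bs z * outViolation b b′ x
        ≡⟨ eq (pathTotal (b′ ∷ bs) z) (pathTotal bs z) (outViolation b b′ x) ⟩
      pathTotal (b′ ∷ bs) z - outViolation b b′ x * pathTotal bs z ∎)
      where
      eq : ∀ s t g → 1ℤ * s + - t * g ≡ s - g * t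
      eq = solve-∀

      e₁ : ∀ v φ → (1ℤ - v) * φ ≡ 1ℤ * φ + - (v * φ)
      e₁ = solve-∀

      e₂ : ∀ v w t → - (v * (w * t)) ≡ - t * (v * w)
      e₂ = solve-∀

      dichotomy : ∀ y → violation b x y * pathSum b′ bs z y ≡ violation b x y * (ω b′ y * pathTotal bs z)
      dichotomy y with L ℕ.+ x ℕ.≤? b ℕ.+ y
      ... | yes ok = trans (cong (_* pathSum b′ bs z y) (violation-false b x y ok))
              (sym (cong (_* (ω b′ y * pathTotal bs z)) (violation-false b x y ok)))
      ... | no bad = cong (violation b x y *_) (pathSum-free b′ bs z y (violated⇒free lb′ x≤b (ℕ.≰⇒> bad)))

      split : ∀ y → edge b x y * pathSum b′ bs z y ≡ 1ℤ * pathSum b′ bs z y + - pathTotal bs z * (violation b x y * ω b′ y)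
      split y = begin
        edge b x y * pathSum b′ bs z y
          ≡⟨ cong (_* pathSum b′ bs z y) (edge≡1-violation b x y) ⟩
        (1ℤ - violation b x y) * pathSum b′ bs z y
          ≡⟨ e₁ (violation b x y) (pathSum b′ bs z y) ⟩
        1ℤ * pathSum b′ bs z y + - (violation b x y * pathSum b′ bs z y)
          ≡⟨ cong (λ u → 1ℤ * pathSum b′ bs z y + - u) (dichotomy y) ⟩
        1ℤ * pathSum b′ bs z y + - (violation b x y * (ω b′ y * pathTotal bs z))
          ≡⟨ cong (_+_ (1ℤ * pathSum b′ bs z y)) (e₂ (violation b x y) (ω b′ y) (pathTotal bs z)) ⟩
        1ℤ * pathSum b′ bs z y + - pathTotal bs z * (violation b x y * ω b′ y) ∎

    -- Summing over the start turns the step into a linear recurrence of order two, whose companion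
    -- matrix is the factor used in `openProduct`.
    pathTotal-step : ∀ {n b b′} → Large b′ → (bs : Vec ℕ n) → ∀ z →
      pathTotal (b ∷ b′ ∷ bs) z ≡ W b * pathTotal (b′ ∷ bs) z - v b b′ * pathTotal bs z
    pathTotal-step {b = b} {b′} lb′ bs z = begin
      ∑ (suc b) (pathSum b (b′ ∷ bs) z)
        ≡⟨ ∑-cong (suc b) (λ x x≤b → trans (pathSum-step lb′ bs z x (ℕ.≤-pred x≤b)) (e₁ (ω b x) S T (outViolation b b′ x))) ⟩
      ∑ (suc b) (λ x → S * ω b x + - T * (ω b x * outViolation b b′ x))
        ≡⟨ ∑-linear (suc b) S (- T) (ω b) (λ x → ω b x * outViolation b b′ x) ⟩
      S * W b + - T * v b b′
        ≡⟨ e₂ (W b) S T (v b b′) ⟩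
      W b * S - v b b′ * T ∎
      where
      S = pathTotal (b′ ∷ bs) z
      T = pathTotal bs z
      e₁ : ∀ w s t g → w * (s - g * t) ≡ s * w + - t * (w * g)
      e₁ = solve-∀
      e₂ : ∀ w s t u → s * w + - t * u ≡ w * s - u * t
      e₂ = solve-∀

    closing : ℕ → ℕ → ℤ
    closing b z = ∑ (suc b) (λ x → ω b x * violation b x z)

    -- The recurrence solved: the column of two consecutive totals is `P` applied to the column (1,
    -- - r). Only r depends on the end point z, through the violated edges into z.
    pathTotal-product : ∀ {n b} {bs : Vec ℕ n} → Large b → All Large bs → ∀ z →
      let P = openProduct W v b bs; r = closing (lastFrom b bs) z in
      pathTotal (b ∷ bs) z ≡ m₁₁ P - r * m₁₂ P × pathTotal bs z ≡ m₂₁ P - r * m₂₂ P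
    pathTotal-product {b = b} {[]} lb [] z = total , e₃ (closing b z)
      where
      e₁ : ∀ w v → w * (1ℤ - v) ≡ 1ℤ * w + -1ℤ * (w * v)
      e₁ = solve-∀
      e₂ : ∀ w r → 1ℤ * w + -1ℤ * r ≡ w - r * 1ℤ
      e₂ = solve-∀
      e₃ : ∀ r → 1ℤ ≡ 1ℤ - r * 0ℤ
      e₃ = solve-∀
      total : pathTotal (b ∷ []) z ≡ W b - closing b z * 1ℤ
      total = begin
        ∑ (suc b) (λ x → ω b x * edge b x z)
          ≡⟨ ∑-cong (suc b) (λ x _ → trans (cong (ω b x *_) (edge≡1-violation b x z)) (e₁ (ω b x) (violation b x z))) ⟩
        ∑ (suc b) (λ x → 1ℤ * ω b x + -1ℤ * (ω b x * violation b x z))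
          ≡⟨ ∑-linear (suc b) 1ℤ -1ℤ (ω b) (λ x → ω b x * violation b x z) ⟩
        1ℤ * W b + -1ℤ * closing b z
          ≡⟨ e₂ (W b) (closing b z) ⟩
        W b - closing b z * 1ℤ ∎
    pathTotal-product {b = b} {b′ ∷ bs} lb (lb′ ∷ lbs) z with S≡ , T≡ ← pathTotal-product lb′ lbs z =
        trans (pathTotal-step lb′ bs z) (trans (cong₂ (λ s t → W b * s - v b b′ * t) S≡ T≡)
          (e₁ (W b) (v b b′) (m₁₁ P) (m₁₂ P) (m₂₁ P) (m₂₂ P) r))
      , trans S≡ (e₂ (m₁₁ P) (m₁₂ P) (m₂₁ P) (m₂₂ P) r)
      where
      P = openProduct W v b′ bs
      r = closing (lastFrom b′ bs) z
      e₁ : ∀ w u a b c d r → w * (a - r * b) - u * (c - r * d) ≡ (w * a + - u * c) - r * (w * b + - u * d)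
      e₁ = solve-∀
      e₂ : ∀ a b c d r → a - r * b ≡ (1ℤ * a + 0ℤ * c) - r * (1ℤ * b + 0ℤ * d)
      e₂ = solve-∀

    ∑-closing : ∀ b e → ∑ (suc b) (λ z → ω b z * closing e z) ≡ v e b
    ∑-closing b e = begin
      ∑ (suc b) (λ z → ω b z * closing e z)
        ≡⟨ ∑-cong (suc b) (λ z _ → sym (∑-*ˡ (suc e) (ω b z) (λ x → ω e x * violation e x z))) ⟩
      ∑ (suc b) (λ z → ∑ (suc e) (λ x → ω b z * (ω e x * violation e x z)))
        ≡⟨ ∑-swap (suc b) (suc e) (λ z x → ω b z * (ω e x * violation e x z)) ⟩
      ∑ (suc e) (λ x → ∑ (suc b) (λ z → ω b z * (ω e x * violation e x z)))
        ≡⟨ ∑-cong (suc e) (λ x _ → trans (∑-cong (suc b) (λ z _ → eq (ω b z) (ω e x) (violation e x z)))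
             (∑-*ˡ (suc b) (ω e x) (λ z → violation e x z * ω b z))) ⟩
      v e b ∎
      where
      eq : ∀ w u v → w * (u * v) ≡ u * (v * w)
      eq = solve-∀

    -- A violated edge out of z needs z > b - L ≥ L, while a violated edge into z needs z < L. So at
    -- the point where the cycle is cut, too, consecutive violations exclude each other.
    out*closing : ∀ {b e} b′ → Large b → Large e → ∀ z → outViolation b b′ z * closing e z ≡ 0ℤ
    out*closing {b} {e} b′ lb le z with L ℕ.+ z ℕ.≤? b
    ... | yes L+z≤b = cong (_* closing e z) (∑-zero (suc b′) λ y _ →
            cong (_* ω b′ y) (violation-false b z y (ℕ.m≤n⇒m≤n+o y L+z≤b)))
    ... | no L+z≰b = trans (cong (outViolation b b′ z *_) (∑-zero (suc e) λ x x≤e →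
            trans (cong (ω e x *_) (violation-false e x z (ok x (ℕ.≤-pred x≤e)))) (ℤ.*-zeroʳ (ω e x))))
            (ℤ.*-zeroʳ (outViolation b b′ z))
      where
      L≤z : L ℕ.≤ z
      L≤z = ℕ.<⇒≤ (ℕ.+-cancelˡ-< L L z (ℕ.≤-<-trans (large⇒L+L≤ lb) (ℕ.≰⇒> L+z≰b)))
      ok : ∀ x → x ℕ.≤ e → L ℕ.+ x ℕ.≤ e ℕ.+ z
      ok x x≤e = ℕ.≤-trans (ℕ.≤-reflexive (ℕ.+-comm L x)) (ℕ.+-mono-≤ x≤e L≤z)

    -- Expanding at the cut vertex z gives terms with no violation at z, with one on the outgoing
    -- edge, with one on the incoming edge, and with both. The last vanishes by `out*closing`; the
    -- sums of the others over z assemble into the trace.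
    cycleSum≡cyclicTrace : ∀ {n b} {bs : Vec ℕ n} → Large b → All Large bs →
      ∑ (suc b) (λ z → pathSum b bs z z) ≡ cyclicTrace W v b bs
    -- In a cycle of length one the edge is a loop and holds because L ≤ b. Accordingly the lower
    -- right entry 0 of the product removes the closing weight.
    cycleSum≡cyclicTrace {b = b} {[]} lb [] = trans
      (∑-cong (suc b) λ z _ → trans
        (cong (ω b z *_) (⟦⟧-true (L ℕ.+ z ℕ.≤? b ℕ.+ z) (ℕ.+-monoˡ-≤ z (ℕ.m+n≤o⇒m≤o L (large⇒L+L≤ lb)))))
        (ℤ.*-identityʳ (ω b z)))
      (eq (W b) (v b b))
      where
      eq : ∀ w u → w ≡ w - u * 0ℤ
      eq = solve-∀
    cycleSum≡cyclicTrace {b = b} {b′ ∷ bs} lb (lb′ ∷ lbs) = begin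
      ∑ (suc b) (λ z → pathSum b (b′ ∷ bs) z z)
        ≡⟨ ∑-cong (suc b) (λ z z≤b → expand z (ℕ.≤-pred z≤b)) ⟩
      ∑ (suc b) (λ z → 1ℤ * (m₁₁ P * ω b z + - m₁₂ P * (ω b z * closing e z)) + - m₂₁ P * (ω b z * outViolation b b′ z))
        ≡⟨ ∑-linear (suc b) 1ℤ (- m₂₁ P) (λ z → m₁₁ P * ω b z + - m₁₂ P * (ω b z * closing e z))
             (λ z → ω b z * outViolation b b′ z) ⟩
      1ℤ * ∑ (suc b) (λ z → m₁₁ P * ω b z + - m₁₂ P * (ω b z * closing e z)) + - m₂₁ P * v b b′
        ≡⟨ cong (λ u → 1ℤ * u + - m₂₁ P * v b b′) (trans
             (∑-linear (suc b) (m₁₁ P) (- m₁₂ P) (ω b) (λ z → ω b z * closing e z))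
             (cong (λ u → m₁₁ P * W b + - m₁₂ P * u) (∑-closing b e))) ⟩
      1ℤ * (m₁₁ P * W b + - m₁₂ P * v e b) + - m₂₁ P * v b b′
        ≡⟨ e₂ (m₁₁ P) (m₁₂ P) (m₂₁ P) (m₂₂ P) (W b) (v e b) (v b b′) ⟩
      cyclicTrace W v b (b′ ∷ bs) ∎
      where
      P = openProduct W v b′ bs
      e = lastFrom b′ bs

      e₁ : ∀ w a b c d r g → w * ((a - r * b) - g * (c - r * d)) ≡
        (1ℤ * (a * w + - b * (w * r)) + - c * (w * g)) + w * d * (g * r)
      e₁ = solve-∀
      e₂ : ∀ a b c d w u t → 1ℤ * (a * w + - b * u) + - c * t ≡ (w * a + - t * c) - u * (1ℤ * b + 0ℤ * d)
      e₂ = solve-∀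
      e₃ : ∀ x w d → x + w * d * 0ℤ ≡ x
      e₃ = solve-∀

      expand : ∀ z → z ℕ.≤ b → pathSum b (b′ ∷ bs) z z ≡
        1ℤ * (m₁₁ P * ω b z + - m₁₂ P * (ω b z * closing e z)) + - m₂₁ P * (ω b z * outViolation b b′ z)
      expand z z≤b with S≡ , T≡ ← pathTotal-product lb′ lbs z = begin
        pathSum b (b′ ∷ bs) z z
          ≡⟨ pathSum-step lb′ bs z z z≤b ⟩
        ω b z * (pathTotal (b′ ∷ bs) z - outViolation b b′ z * pathTotal bs z)
          ≡⟨ cong₂ (λ s t → ω b z * (s - outViolation b b′ z * t)) S≡ T≡ ⟩
        ω b z * ((m₁₁ P - closing e z * m₁₂ P) - outViolation b b′ z * (m₂₁ P - closing e z * m₂₂ P))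
          ≡⟨ e₁ (ω b z) (m₁₁ P) (m₁₂ P) (m₂₁ P) (m₂₂ P) (closing e z) (outViolation b b′ z) ⟩
        R + ω b z * m₂₂ P * (outViolation b b′ z * closing e z)
          ≡⟨ cong (λ u → R + ω b z * m₂₂ P * u) (out*closing b′ lb (lastFrom⁺ lb′ lbs) z) ⟩
        R + ω b z * m₂₂ P * 0ℤ
          ≡⟨ e₃ R (ω b z) (m₂₂ P) ⟩
        R ∎
        where R = 1ℤ * (m₁₁ P * ω b z + - m₁₂ P * (ω b z * closing e z)) + - m₂₁ P * (ω b z * outViolation b b′ z)

    boxSum≡cyclicTrace : ∀ {n b} {bs : Vec ℕ n} → Large b → All Large bs →
      ∑ (suc b) (λ z → boxSum bs (λ xs → edgeProduct (b ∷ bs) (z ∷ xs) (xs ∷ʳ z) * weight (b ∷ bs) (z ∷ xs)))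
        ≡ cyclicTrace W v b bs
    boxSum≡cyclicTrace {b = b} {bs} lb lbs =
      trans (∑-cong (suc b) (λ z _ → boxSum≡pathSum b bs z z)) (cycleSum≡cyclicTrace lb lbs)

-- Generating functions

∸-split : ∀ {b L u} → L ℕ.≤ b → u ℕ.≤ L → b ∸ u ≡ (b ∸ L) ℕ.+ (L ∸ u)
∸-split {b} {L} {u} L≤b u≤L = trans (cong (_∸ u) (sym (ℕ.m∸n+n≡m L≤b))) (ℕ.+-∸-assoc (b ∸ L) u≤L)

degree : ∀ {n} → (ℕ → ℕ → ℕ) → Vec ℕ n → Vec ℕ n → ℕ
degree e []       []       = 0
degree e (b ∷ bs) (x ∷ xs) = e b x ℕ.+ degree e bs xs

rotate : ∀ {A : Set} {n} → Vec A n → Vec A n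
rotate []       = []
rotate (x ∷ xs) = xs ∷ʳ x

coordinate cocoordinate : ℕ → ℕ → ℕ
coordinate   b x = x
cocoordinate b x = b ∸ x

-- Coefficients of integer polynomials

∑-pick : ∀ {n d} (f : ℕ → ℤ) → d ℕ.< n → ∑ n (λ T → ⟦ d ℕ.≟ T ⟧ * f T) ≡ f d
∑-pick {suc n} {zero}  f _ = trans
  (cong₂ _+_ (ℤ.*-identityˡ (f 0)) (∑-zero n (λ T _ → refl))) (ℤ.+-identityʳ (f 0))
∑-pick {suc n} {suc d} f (s≤s d<n) = trans (ℤ.+-identityˡ _) (∑-pick (f ∘ suc) d<n)

multiple-of-larger : ∀ m k → m ≡ suc m ℕ.* k → m ≡ 0
multiple-of-larger m zero    eq = trans eq (ℕ.*-zeroʳ m)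
multiple-of-larger m (suc k) eq = contradiction eq
  (ℕ.<⇒≢ (ℕ.<-≤-trans (ℕ.n<1+n m) (ℕ.m≤m*n (suc m) (suc k))))

-- The values are given at positive q only, so the constant term is not read off at q = 0. It is
-- divisible by every positive q, in particular by one exceeding its absolute value. Once it is
-- zero, a factor q cancels and the argument repeats on the higher coefficients.
polynomial-zero : ∀ n (h : ℕ → ℤ) → (∀ q .{{_ : ℕ.NonZero q}} → ∑ n (λ T → h T * (+ q) ^ T) ≡ 0ℤ) →
  ∀ T → T ℕ.< n → h T ≡ 0ℤ
polynomial-zero (suc n) h vanish = coefficient
  where
  higher : ℕ → ℤ
  higher q = ∑ n (λ T → h (suc T) * (+ q) ^ T)

  horner : ∀ q .{{_ : ℕ.NonZero q}} → h 0 + + q * higher q ≡ 0ℤ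
  horner q = trans (sym (cong₂ _+_ (ℤ.*-identityʳ (h 0))
    (trans (∑-cong n (λ T _ → eq (h (suc T)) (+ q) ((+ q) ^ T))) (∑-*ˡ n (+ q) (λ T → h (suc T) * (+ q) ^ T)))))
    (vanish q)
    where
    eq : ∀ a q r → a * (q * r) ≡ q * (a * r)
    eq = solve-∀

  -- q = ∣ h 0 ∣ + 1 divides h 0.
  constant : h 0 ≡ 0ℤ
  constant = ℤ.∣i∣≡0⇒i≡0 (multiple-of-larger ℤ.∣ h 0 ∣ ℤ.∣ higher q ∣ (begin
    ℤ.∣ h 0 ∣                  ≡⟨ cong ℤ.∣_∣ (ℤ.i-j≡0⇒i≡j (h 0) (- (+ q * higher q))
                                    (trans (cong (_+_ (h 0)) (ℤ.neg-involutive (+ q * higher q))) (horner q))) ⟩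
    ℤ.∣ - (+ q * higher q) ∣   ≡⟨ ℤ.∣-i∣≡∣i∣ (+ q * higher q) ⟩
    ℤ.∣ + q * higher q ∣       ≡⟨ ℤ.abs-* (+ q) (higher q) ⟩
    q ℕ.* ℤ.∣ higher q ∣       ∎))
    where
    q = suc ℤ.∣ h 0 ∣

  coefficient : ∀ T → T ℕ.< suc n → h T ≡ 0ℤ
  coefficient zero    _         = constant
  coefficient (suc T) (s≤s T<n) = polynomial-zero n (h ∘ suc) vanish′ T T<n
    where
    vanish′ : ∀ q .{{_ : ℕ.NonZero q}} → higher q ≡ 0ℤ
    vanish′ q@(suc _) = ℤ.*-cancelˡ-≡ (+ q) (higher q) 0ℤ (begin
      + q * higher q          ≡⟨ ℤ.+-identityˡ _ ⟨
      0ℤ + + q * higher q     ≡⟨ cong (_+ + q * higher q) constant ⟨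
      h 0 + + q * higher q    ≡⟨ horner q ⟩
      0ℤ                      ≡⟨ ℤ.*-zeroʳ (+ q) ⟨
      + q * 0ℤ                ∎)

polynomial-injective : ∀ n (f g : ℕ → ℤ) →
  (∀ q .{{_ : ℕ.NonZero q}} → ∑ n (λ T → f T * (+ q) ^ T) ≡ ∑ n (λ T → g T * (+ q) ^ T)) →
  ∀ T → T ℕ.< n → f T ≡ g T
polynomial-injective n f g same T T<n =
  ℤ.i-j≡0⇒i≡j (f T) (g T) (polynomial-zero n (λ T → f T - g T) vanish T T<n)
  where
  e₁ : ∀ a b r → (a - b) * r ≡ 1ℤ * (a * r) + -1ℤ * (b * r)
  e₁ = solve-∀
  e₂ : ∀ a → 1ℤ * a + -1ℤ * a ≡ 0ℤ
  e₂ = solve-∀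
  vanish : ∀ q .{{_ : ℕ.NonZero q}} → ∑ n (λ T → (f T - g T) * (+ q) ^ T) ≡ 0ℤ
  vanish q = begin
    ∑ n (λ T → (f T - g T) * (+ q) ^ T)
      ≡⟨ ∑-cong n (λ T _ → e₁ (f T) (g T) ((+ q) ^ T)) ⟩
    ∑ n (λ T → 1ℤ * (f T * (+ q) ^ T) + -1ℤ * (g T * (+ q) ^ T))
      ≡⟨ ∑-linear n 1ℤ -1ℤ (λ T → f T * (+ q) ^ T) (λ T → g T * (+ q) ^ T) ⟩
    1ℤ * ∑ n (λ T → f T * (+ q) ^ T) + -1ℤ * ∑ n (λ T → g T * (+ q) ^ T)
      ≡⟨ cong (λ u → 1ℤ * ∑ n (λ T → f T * (+ q) ^ T) + -1ℤ * u) (same q) ⟨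
    1ℤ * ∑ n (λ T → f T * (+ q) ^ T) + -1ℤ * ∑ n (λ T → f T * (+ q) ^ T)
      ≡⟨ e₂ (∑ n (λ T → f T * (+ q) ^ T)) ⟩
    0ℤ ∎

*-nonneg : ∀ {i j} → 0ℤ ℤ.≤ i → 0ℤ ℤ.≤ j → 0ℤ ℤ.≤ i * j
*-nonneg {+ m} {+ n} _ _ = subst (0ℤ ℤ.≤_) (ℤ.pos-* m n) (+≤+ z≤n)

^-positive : ∀ m n → 0ℤ ℤ.< (+ suc m) ^ n
^-positive m zero    = ℤ.+<+ (s≤s z≤n)
^-positive m (suc n) = subst (ℤ._< (+ suc m) ^ suc n) (ℤ.*-zeroʳ (+ suc m))
  (ℤ.*-monoˡ-<-pos (+ suc m) (^-positive m n))

-- Generating functions and counts for the cyclic constraints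

module Counting (L : ℕ) where

  open Cycle L

  cyclicEdges : ∀ {n} → Vec ℕ n → Vec ℕ n → ℤ
  cyclicEdges bs xs = edgeProduct bs xs (rotate xs)

  large⇒L≤ : ∀ {b} → Large b → L ℕ.≤ b
  large⇒L≤ = ℕ.m+n≤o⇒m≤o L ∘ large⇒L+L≤

  -- With the source measured from the top as u = b - x, violation becomes u + y < L: a condition
  -- free of b and symmetric in u and y. The symmetry is what relates the two weights.
  below : ℕ → ℕ → ℤ
  below u y = ⟦ u ℕ.+ y ℕ.<? L ⟧

  below-false : ∀ u y → L ℕ.≤ u ℕ.+ y → below u y ≡ 0ℤ
  below-false u y L≤u+y = ⟦⟧-false (u ℕ.+ y ℕ.<? L) (ℕ.≤⇒≯ L≤u+y)

  below-comm : ∀ u y → below u y ≡ below y u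
  below-comm u y = cong (λ w → ⟦ w ℕ.<? L ⟧) (ℕ.+-comm u y)

  violation-reflect : ∀ {b u} y → u ℕ.≤ b → violation b (b ∸ u) y ≡ below u y
  violation-reflect {b} {u} y u≤b = ⟦⟧-cong (b ℕ.+ y ℕ.<? L ℕ.+ (b ∸ u)) (u ℕ.+ y ℕ.<? L)
    (ℕ.+-cancelˡ-< (b ∸ u) _ _ ∘ subst₂ ℕ._<_ eqˡ (ℕ.+-comm L (b ∸ u)))
    (subst₂ ℕ._<_ (sym eqˡ) (ℕ.+-comm (b ∸ u) L) ∘ ℕ.+-monoʳ-< (b ∸ u))
    where
    eqˡ : b ℕ.+ y ≡ (b ∸ u) ℕ.+ (u ℕ.+ y)
    eqˡ = trans (cong (ℕ._+ y) (sym (ℕ.m∸n+n≡m u≤b))) (ℕ.+-assoc (b ∸ u) u y)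

  -- After reflecting the source, the violating pairs fill the triangle u + y < L, which lies inside
  -- the box. Both ranges can therefore be cut to `L`, the same for all bounds.
  v-corner : ∀ ω {b b′} → L ℕ.≤ b → L ℕ.≤ b′ → Transfer.v ω b b′ ≡
    ∑ L (λ u → ω b (b ∸ u) * ∑ L (λ y → below u y * ω b′ y))
  v-corner ω {b} {b′} L≤b L≤b′ = begin
    ∑ (suc b) (λ x → ω b x * Transfer.outViolation ω b b′ x)
      ≡⟨ ∑-reflect b (λ x → ω b x * Transfer.outViolation ω b b′ x) ⟩
    ∑ (suc b) (λ u → ω b (b ∸ u) * Transfer.outViolation ω b b′ (b ∸ u))
      ≡⟨ ∑-cong (suc b) (λ u u≤b → cong (ω b (b ∸ u) *_) (∑-cong (suc b′)
           (λ y _ → cong (_* ω b′ y) (violation-reflect y (ℕ.≤-pred u≤b))))) ⟩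
    ∑ (suc b) (λ u → ω b (b ∸ u) * ∑ (suc b′) (λ y → below u y * ω b′ y))
      ≡⟨ ∑-cong (suc b) (λ u _ → cong (ω b (b ∸ u) *_) (∑-truncate (λ y → below u y * ω b′ y) (ℕ.m≤n⇒m≤1+n L≤b′)
           (λ y L≤y → cong (_* ω b′ y) (below-false u y (ℕ.m≤n⇒m≤o+n u L≤y))))) ⟩
    ∑ (suc b) (λ u → ω b (b ∸ u) * ∑ L (λ y → below u y * ω b′ y))
      ≡⟨ ∑-truncate (λ u → ω b (b ∸ u) * ∑ L (λ y → below u y * ω b′ y)) (ℕ.m≤n⇒m≤1+n L≤b)
           (λ u L≤u → trans (cong (ω b (b ∸ u) *_) (∑-zero L (λ y _ → cong (_* ω b′ y) (below-false u y (ℕ.m≤n⇒m≤n+o y L≤u)))))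
             (ℤ.*-zeroʳ (ω b (b ∸ u)))) ⟩
    ∑ L (λ u → ω b (b ∸ u) * ∑ L (λ y → below u y * ω b′ y)) ∎

  module Evaluation (q : ℤ) where

    ω : (ℕ → ℕ → ℕ) → ℕ → ℕ → ℤ
    ω e b x = q ^ e b x

    open Transfer

    weight≡^degree : ∀ e {n} (bs xs : Vec ℕ n) → weight (ω e) bs xs ≡ q ^ degree e bs xs
    weight≡^degree e []       []       = refl
    weight≡^degree e (b ∷ bs) (x ∷ xs) = trans (cong (q ^ e b x *_) (weight≡^degree e bs xs))
      (sym (ℤ.^-distribˡ-+-* q (e b x) (degree e bs xs)))

    -- The constant c of the violation weights: the sum of q^((L - u) + y) over the triangle u + y <
    -- L.
    corner : ℤ
    corner = ∑ L (λ u → q ^ (L ∸ u) * ∑ L (λ y → below u y * q ^ y))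

    Q : ℕ → ℤ
    Q b = q ^ (b ∸ L)

    ^-∸-split : ∀ {b u} → L ℕ.≤ b → u ℕ.≤ L → q ^ (b ∸ u) ≡ Q b * q ^ (L ∸ u)
    ^-∸-split {b} {u} L≤b u≤L = trans (cong (q ^_) (∸-split L≤b u≤L)) (ℤ.^-distribˡ-+-* q (b ∸ L) (L ∸ u))

    v-coordinate : ∀ {b b′} → Large b → Large b′ → v (ω coordinate) b b′ ≡ corner * Q b
    v-coordinate {b} {b′} lb lb′ = begin
      v (ω coordinate) b b′
        ≡⟨ v-corner (ω coordinate) (large⇒L≤ lb) (large⇒L≤ lb′) ⟩
      ∑ L (λ u → q ^ (b ∸ u) * K u)
        ≡⟨ ∑-cong L (λ u u<L → trans (cong (_* K u) (^-∸-split (large⇒L≤ lb) (ℕ.<⇒≤ u<L)))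
             (ℤ.*-assoc (Q b) (q ^ (L ∸ u)) (K u))) ⟩
      ∑ L (λ u → Q b * (q ^ (L ∸ u) * K u))
        ≡⟨ ∑-*ˡ L (Q b) (λ u → q ^ (L ∸ u) * K u) ⟩
      Q b * corner
        ≡⟨ ℤ.*-comm (Q b) corner ⟩
      corner * Q b ∎
      where
      K : ℕ → ℤ
      K u = ∑ L (λ y → below u y * q ^ y)

    -- The complementary weight of a pair is q^u q^(b′ - y). Exchanging u and y preserves the
    -- triangle and gives back the same constant, but now the power split off is that of the target.
    v-cocoordinate : ∀ {b b′} → Large b → Large b′ → v (ω cocoordinate) b b′ ≡ corner * Q b′
    v-cocoordinate {b} {b′} lb lb′ = begin
      v (ω cocoordinate) b b′
        ≡⟨ v-corner (ω cocoordinate) (large⇒L≤ lb) (large⇒L≤ lb′) ⟩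
      ∑ L (λ u → q ^ (b ∸ (b ∸ u)) * ∑ L (λ y → below u y * q ^ (b′ ∸ y)))
        ≡⟨ ∑-cong L (λ u u<L → trans (sym (∑-*ˡ L (q ^ (b ∸ (b ∸ u))) (λ y → below u y * q ^ (b′ ∸ y))))
             (∑-cong L (λ y y<L → rearrange u y (ℕ.<⇒≤ u<L) (ℕ.<⇒≤ y<L)))) ⟩
      ∑ L (λ u → ∑ L (λ y → (Q b′ * q ^ (L ∸ y)) * (below y u * q ^ u)))
        ≡⟨ ∑-swap L L (λ u y → (Q b′ * q ^ (L ∸ y)) * (below y u * q ^ u)) ⟩
      ∑ L (λ y → ∑ L (λ u → (Q b′ * q ^ (L ∸ y)) * (below y u * q ^ u)))
        ≡⟨ ∑-cong L (λ y _ → trans (∑-*ˡ L (Q b′ * q ^ (L ∸ y)) (λ u → below y u * q ^ u)) (ℤ.*-assoc (Q b′) (q ^ (L ∸ y)) _)) ⟩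
      ∑ L (λ y → Q b′ * (q ^ (L ∸ y) * ∑ L (λ u → below y u * q ^ u)))
        ≡⟨ ∑-*ˡ L (Q b′) (λ y → q ^ (L ∸ y) * ∑ L (λ u → below y u * q ^ u)) ⟩
      Q b′ * corner
        ≡⟨ ℤ.*-comm (Q b′) corner ⟩
      corner * Q b′ ∎
      where
      eq : ∀ x y z → x * (y * z) ≡ z * (y * x)
      eq = solve-∀
      rearrange : ∀ u y → u ℕ.≤ L → y ℕ.≤ L → q ^ (b ∸ (b ∸ u)) * (below u y * q ^ (b′ ∸ y)) ≡
        (Q b′ * q ^ (L ∸ y)) * (below y u * q ^ u)
      rearrange u y u≤L y≤L = trans
        (cong₂ (λ i r → q ^ i * r) (ℕ.m∸[m∸n]≡n (ℕ.≤-trans u≤L (large⇒L≤ lb)))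
          (cong₂ _*_ (below-comm u y) (^-∸-split (large⇒L≤ lb′) y≤L)))
        (eq (q ^ u) (below y u) (Q b′ * q ^ (L ∸ y)))

    W-reflect : ∀ b → W (ω cocoordinate) b ≡ W (ω coordinate) b
    W-reflect b = sym (∑-reflect b (q ^_))

    geometric : ∀ n → (q - 1ℤ) * ∑ n (q ^_) + 1ℤ ≡ q ^ n
    geometric zero    = cong (_+ 1ℤ) (ℤ.*-zeroʳ (q - 1ℤ))
    geometric (suc n) = begin
      (q - 1ℤ) * ∑ (suc n) (q ^_) + 1ℤ            ≡⟨ cong (λ s → (q - 1ℤ) * s + 1ℤ) (∑-last n (q ^_)) ⟩
      (q - 1ℤ) * (∑ n (q ^_) + q ^ n) + 1ℤ        ≡⟨ e₁ q (∑ n (q ^_)) (q ^ n) ⟩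
      ((q - 1ℤ) * ∑ n (q ^_) + 1ℤ) + (q - 1ℤ) * q ^ n ≡⟨ cong (_+ (q - 1ℤ) * q ^ n) (geometric n) ⟩
      q ^ n + (q - 1ℤ) * q ^ n                    ≡⟨ e₂ q (q ^ n) ⟩
      q * q ^ n                                   ∎
      where
      e₁ : ∀ q s r → (q - 1ℤ) * (s + r) + 1ℤ ≡ ((q - 1ℤ) * s + 1ℤ) + (q - 1ℤ) * r
      e₁ = solve-∀
      e₂ : ∀ q r → r + (q - 1ℤ) * r ≡ q * r
      e₂ = solve-∀

    -- The geometric series gives q^(b + 1), split so that one factor is independent of b. This is
    -- the relation on which the conjugation by `G` rests.
    W-geometric : ∀ {b} → Large b → (q - 1ℤ) * W (ω coordinate) b + 1ℤ ≡ q ^ suc L * Q b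
    W-geometric {b} lb = trans (geometric (suc b))
      (trans (cong (λ i → q ^ suc i) (sym (ℕ.m+[n∸m]≡n (large⇒L≤ lb)))) (ℤ.^-distribˡ-+-* q (suc L) (b ∸ L)))

    generating : (ℕ → ℕ → ℕ) → ∀ {n} → Vec ℕ n → ℤ
    generating e bs = boxSum bs (λ xs → cyclicEdges bs xs * q ^ degree e bs xs)

    generating≡cyclicTrace : ∀ e {n b} {bs : Vec ℕ n} → Large b → All Large bs →
      generating e (b ∷ bs) ≡ cyclicTrace (W (ω e)) (v (ω e)) b bs
    generating≡cyclicTrace e {b = b} {bs} lb lbs = trans
      (∑-cong (suc b) (λ z _ → boxSum-cong bs (λ xs _ →
        cong (edgeProduct (b ∷ bs) (z ∷ xs) (xs ∷ʳ z) *_) (sym (weight≡^degree e (b ∷ bs) (z ∷ xs))))))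
      (boxSum≡cyclicTrace (ω e) lb lbs)

    corner-nonneg : 0ℤ ℤ.≤ q → 0ℤ ℤ.≤ corner
    corner-nonneg 0≤q = ∑-nonneg L _ λ u → *-nonneg (^-nonneg (L ∸ u))
      (∑-nonneg L _ λ y → *-nonneg (⟦⟧-nonneg (u ℕ.+ y ℕ.<? L)) (^-nonneg y))
      where
      ^-nonneg : ∀ n → 0ℤ ℤ.≤ q ^ n
      ^-nonneg zero    = +≤+ z≤n
      ^-nonneg (suc n) = *-nonneg 0≤q (^-nonneg n)

  generating-symmetric : ∀ q .{{_ : ℕ.NonZero q}} {n} {bs : Vec ℕ n} → All Large bs →
    let open Evaluation (+ q) in generating coordinate bs ≡ generating cocoordinate bs
  generating-symmetric q []        = refl
  generating-symmetric q@(suc m) {bs = b ∷ bs} (lb ∷ lbs) = begin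
    generating coordinate (b ∷ bs)
      ≡⟨ generating≡cyclicTrace coordinate lb lbs ⟩
    cyclicTrace (W (ω coordinate)) (v (ω coordinate)) b bs
      ≡⟨ cyclicTrace-cong (λ _ → refl) v-coordinate lb lbs ⟩
    cyclicTrace (W (ω coordinate)) forward b bs
      ≡⟨ cyclicTrace-reversal W-geometric {{det≢0}} lb lbs ⟩
    cyclicTrace (W (ω coordinate)) backward b bs
      ≡⟨ cyclicTrace-cong W-reflect v-cocoordinate lb lbs ⟨
    cyclicTrace (W (ω cocoordinate)) (v (ω cocoordinate)) b bs
      ≡⟨ generating≡cyclicTrace cocoordinate lb lbs ⟨
    generating cocoordinate (b ∷ bs) ∎
    where
    open Evaluation (+ q)
    open Transfer using (W; v)
    open Reversal (W (ω coordinate)) Q (+ q - 1ℤ) ((+ q) ^ suc L) corner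
    -- Here `det G` = q^(L + 1) + (q - 1)² c. The first term is positive and the second nonnegative,
    -- as q ≥ 1 and c ≥ 0; `+ m` is the normal form of q - 1.
    det≢0 : ℤ.NonZero (det G)
    det≢0 = ℤ.>-nonZero (subst (0ℤ ℤ.<_) (eq ((+ q) ^ suc L) (+ q - 1ℤ) corner)
      (ℤ.+-mono-<-≤ (^-positive m (suc L)) (*-nonneg {+ m} (+≤+ z≤n) (*-nonneg {+ m} (+≤+ z≤n) (corner-nonneg (+≤+ z≤n))))))
      where
      eq : ∀ A p c → A + p * (p * c) ≡ A * 1ℤ - - (p * c) * p
      eq = solve-∀

  count : (ℕ → ℕ → ℕ) → ∀ {n} → Vec ℕ n → ℕ → ℤ
  count e bs T = boxSum bs (λ xs → cyclicEdges bs xs * ⟦ degree e bs xs ℕ.≟ T ⟧)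

  Bounded : (ℕ → ℕ → ℕ) → Set
  Bounded e = ∀ {b x} → x ℕ.≤ b → e b x ℕ.≤ b

  degree-bounded : ∀ {e} → Bounded e → ∀ {n} {bs xs : Vec ℕ n} → Pointwise ℕ._≤_ xs bs →
    degree e bs xs ℕ.≤ Vec.sum bs
  degree-bounded bound []           = z≤n
  degree-bounded bound (x≤b ∷ xs≤bs) = ℕ.+-mono-≤ (bound x≤b) (degree-bounded bound xs≤bs)

  -- The points are sorted by degree: q^d is written as the sum over T < M of [d = T] q^T, which
  -- picks up its term because every degree is at most the sum of the bounds.
  generating-polynomial : ∀ {e} → Bounded e → ∀ q {n} (bs : Vec ℕ n) {M} → Vec.sum bs ℕ.< M →
    Evaluation.generating q e bs ≡ ∑ M (λ T → count e bs T * q ^ T)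
  generating-polynomial {e} bound q bs {M} Σ<M = begin
    boxSum bs (λ xs → cyclicEdges bs xs * q ^ degree e bs xs)
      ≡⟨ boxSum-cong bs (λ xs xs≤bs → expand xs (ℕ.≤-<-trans (degree-bounded bound xs≤bs) Σ<M)) ⟩
    boxSum bs (λ xs → ∑ M (λ T → q ^ T * (cyclicEdges bs xs * ⟦ degree e bs xs ℕ.≟ T ⟧)))
      ≡⟨ boxSum-∑ bs M (λ xs T → q ^ T * (cyclicEdges bs xs * ⟦ degree e bs xs ℕ.≟ T ⟧)) ⟩
    ∑ M (λ T → boxSum bs (λ xs → q ^ T * (cyclicEdges bs xs * ⟦ degree e bs xs ℕ.≟ T ⟧)))
      ≡⟨ ∑-cong M (λ T _ → trans
           (boxSum-*ˡ bs (q ^ T) (λ xs → cyclicEdges bs xs * ⟦ degree e bs xs ℕ.≟ T ⟧))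
           (ℤ.*-comm (q ^ T) (count e bs T))) ⟩
    ∑ M (λ T → count e bs T * q ^ T) ∎
    where
    eq : ∀ c i r → c * (i * r) ≡ r * (c * i)
    eq = solve-∀
    expand : ∀ xs → degree e bs xs ℕ.< M → cyclicEdges bs xs * q ^ degree e bs xs ≡
      ∑ M (λ T → q ^ T * (cyclicEdges bs xs * ⟦ degree e bs xs ℕ.≟ T ⟧))
    expand xs d<M = begin
      cyclicEdges bs xs * q ^ degree e bs xs
        ≡⟨ cong (cyclicEdges bs xs *_) (∑-pick (q ^_) d<M) ⟨
      cyclicEdges bs xs * ∑ M (λ T → ⟦ degree e bs xs ℕ.≟ T ⟧ * q ^ T)
        ≡⟨ ∑-*ˡ M (cyclicEdges bs xs) (λ T → ⟦ degree e bs xs ℕ.≟ T ⟧ * q ^ T) ⟨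
      ∑ M (λ T → cyclicEdges bs xs * (⟦ degree e bs xs ℕ.≟ T ⟧ * q ^ T))
        ≡⟨ ∑-cong M (λ T _ → eq (cyclicEdges bs xs) ⟦ degree e bs xs ℕ.≟ T ⟧ (q ^ T)) ⟩
      ∑ M (λ T → q ^ T * (cyclicEdges bs xs * ⟦ degree e bs xs ℕ.≟ T ⟧)) ∎

  count-symmetric : ∀ {n} {bs : Vec ℕ n} → All Large bs → ∀ T → count coordinate bs T ≡ count cocoordinate bs T
  count-symmetric {bs = bs} large T = polynomial-injective M (count coordinate bs) (count cocoordinate bs)
    (λ q → trans (sym (generating-polynomial (λ x≤b → x≤b) (+ q) bs Σ<M))
      (trans (generating-symmetric q large)
        (generating-polynomial (λ {b} {x} _ → ℕ.m∸n≤m b x) (+ q) bs Σ<M)))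
    T (s≤s (ℕ.m≤n+m T (Vec.sum bs)))
    where
    -- Large enough to exceed both every occurring degree and the given T, so that T indexes a
    -- coefficient of the polynomial.
    M = suc (Vec.sum bs ℕ.+ T)
    Σ<M : Vec.sum bs ℕ.< M
    Σ<M = s≤s (ℕ.m≤m+n (Vec.sum bs) T)

-- Lattice points of the dilates

length-filter-map : ∀ {A B : Set} {P : B → Set} (P? : Decidable P) (f : A → B) xs →
  length (filter P? (List.map f xs)) ≡ length (filter (P? ∘ f) xs)
length-filter-map P? f List.[] = refl
length-filter-map P? f (x List.∷ xs) with P? (f x)
... | yes _ = cong suc (length-filter-map P? f xs)
... | no _  = length-filter-map P? f xs

-- Stated for a general `g`, since `upTo` unfolds to `applyUpTo`, whose recursion replaces `g` by
-- `g ∘ suc`.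
length-filter-product : ∀ {n} {P : Vec ℤ (suc n) → Set} (P? : Decidable P) m g zs →
  + length (filter P? (cartesianProductWith _∷_ (List.map +_ (applyUpTo g m)) zs)) ≡
  ∑ m (λ x → + length (filter (λ z → P? (+ g x ∷ z)) zs))
length-filter-product P? zero    g zs = refl
length-filter-product P? (suc m) g zs = begin
  + length (filter P? (first List.++ rest))
    ≡⟨ cong (+_ ∘ length) (List.filter-++ P? first rest) ⟩
  + length (filter P? first List.++ filter P? rest)
    ≡⟨ cong +_ (List.length-++ (filter P? first)) ⟩
  + (length (filter P? first) ℕ.+ length (filter P? rest))
    ≡⟨ cong₂ (λ i j → + i + j) (length-filter-map P? (+ g 0 ∷_) zs) (length-filter-product P? m (g ∘ suc) zs) ⟩
  ∑ (suc m) (λ x → + length (filter (λ z → P? (+ g x ∷ z)) zs)) ∎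
  where
  first = List.map (+ g 0 ∷_) zs
  rest  = cartesianProductWith _∷_ (List.map +_ (applyUpTo (g ∘ suc) m)) zs

length-filter-box : ∀ {n} {P : Vec ℤ n → Set} (P? : Decidable P) k (a : Vec ℕ n) →
  + length (filter P? (box k a)) ≡ boxSum (map (k ℕ.*_) a) (λ xs → ⟦ P? (map +_ xs) ⟧)
length-filter-box P? k [] with P? []
... | yes _ = refl
... | no _  = refl
length-filter-box P? k (b ∷ bs) = trans
  (length-filter-product P? (suc (k ℕ.* b)) (λ x → x) (box k bs))
  (∑-cong (suc (k ℕ.* b)) (λ x _ → length-filter-box (λ z → P? (+ x ∷ z)) k bs))

⟦⟧-× : ∀ {P Q : Set} (P? : Dec P) (Q? : Dec Q) → ⟦ P? ⟧ * ⟦ Q? ⟧ ≡ ⟦ P? ×-dec Q? ⟧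
⟦⟧-× (yes _) (yes _) = refl
⟦⟧-× (yes _) (no _)  = refl
⟦⟧-× (no _)  (yes _) = refl
⟦⟧-× (no _)  (no _)  = refl

next-inject₁ : ∀ {m} (i : Fin m) → next (inject₁ i) ≡ suc i
next-inject₁ {m} i = Fin.toℕ-injective (trans (Fin.toℕ-fromℕ< _)
  (trans (cong (λ j → suc j ℕ.% suc m) (Fin.toℕ-inject₁ i)) (m<n⇒m%n≡m (s≤s (Fin.toℕ<n i)))))

next-fromℕ : ∀ m → next (Fin.fromℕ m) ≡ zero
next-fromℕ m = Fin.toℕ-injective (trans (Fin.toℕ-fromℕ< _)
  (trans (cong (λ j → suc j ℕ.% suc m) (Fin.toℕ-fromℕ m)) (n%n≡0 (suc m))))

lookup-∷ʳ-inject₁ : ∀ {A : Set} {n} (xs : Vec A n) y i → lookup (xs ∷ʳ y) (inject₁ i) ≡ lookup xs i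
lookup-∷ʳ-inject₁ (x ∷ xs) y zero    = refl
lookup-∷ʳ-inject₁ (x ∷ xs) y (suc i) = lookup-∷ʳ-inject₁ xs y i

lookup-∷ʳ-fromℕ : ∀ {A : Set} {n} (xs : Vec A n) y → lookup (xs ∷ʳ y) (Fin.fromℕ n) ≡ y
lookup-∷ʳ-fromℕ []       y = refl
lookup-∷ʳ-fromℕ (x ∷ xs) y = lookup-∷ʳ-fromℕ xs y

-- Links the modular successor of the definition to the shifted vector used by `edgeProduct`. The
-- last index wraps around to the head, which `rotate` has moved to the end.
lookup-next : ∀ {A : Set} {n} (xs : Vec A n) i → lookup xs (next i) ≡ lookup (rotate xs) i
lookup-next (x ∷ xs) i with view i
... | ‵fromℕ     = trans (cong (lookup (x ∷ xs)) (next-fromℕ _)) (sym (lookup-∷ʳ-fromℕ xs x))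
... | ‵inject₁ j = trans (cong (lookup (x ∷ xs)) (next-inject₁ j)) (sym (lookup-∷ʳ-inject₁ xs x j))

edgeProduct-⟦⟧ : ∀ L {n} (bs xs ys : Vec ℕ n)
  (all? : Dec (∀ i → L ℕ.+ lookup xs i ℕ.≤ lookup bs i ℕ.+ lookup ys i)) →
  Cycle.edgeProduct L bs xs ys ≡ ⟦ all? ⟧
edgeProduct-⟦⟧ L [] [] [] all? = sym (⟦⟧-true all? λ ())
edgeProduct-⟦⟧ L (b ∷ bs) (x ∷ xs) (y ∷ ys) all? = begin
  Cycle.edge L b x y * Cycle.edgeProduct L bs xs ys
    ≡⟨ cong (Cycle.edge L b x y *_) (edgeProduct-⟦⟧ L bs xs ys tail?) ⟩
  ⟦ head? ⟧ * ⟦ tail? ⟧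
    ≡⟨ ⟦⟧-× head? tail? ⟩
  ⟦ head? ×-dec tail? ⟧
    ≡⟨ ⟦⟧-cong (head? ×-dec tail?) all? (λ { (p , ps) zero → p ; (p , ps) (suc i) → ps i }) (λ ps → ps zero , ps ∘ suc) ⟩
  ⟦ all? ⟧ ∎
  where
  head? = L ℕ.+ x ℕ.≤? b ℕ.+ y
  tail? = Fin.all? (λ i → L ℕ.+ lookup xs i ℕ.≤? lookup bs i ℕ.+ lookup ys i)

-- Integers inside the rationals

fromℤ-+ : ∀ z w → fromℤ z ℚ.+ fromℤ w ≡ fromℤ (z + w)
fromℤ-+ z w = ℚ.toℚᵘ-injective (ℚᵘ.≃-trans (ℚ.toℚᵘ-homo-+ (fromℤ z) (fromℤ w))
  (ℚᵘ.≃-trans (ℚᵘ.+-cong (toℚᵘ-fromℤ z) (toℚᵘ-fromℤ w))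
    (ℚᵘ.≃-trans (ℚᵘ.*≡* (eq z w)) (ℚᵘ.≃-sym (toℚᵘ-fromℤ (z + w))))))
  where
  eq : ∀ z w → (z * 1ℤ + w * 1ℤ) * 1ℤ ≡ (z + w) * 1ℤ
  eq = solve-∀

fromℤ-neg : ∀ z → ℚ.- fromℤ z ≡ fromℤ (- z)
fromℤ-neg z = ℚ.toℚᵘ-injective (ℚᵘ.≃-trans (ℚ.toℚᵘ-homo‿- (fromℤ z))
  (ℚᵘ.≃-trans (ℚᵘ.-‿cong (toℚᵘ-fromℤ z)) (ℚᵘ.≃-sym (toℚᵘ-fromℤ (- z)))))

fromℤ-minus : ∀ z w → fromℤ z ℚ.- fromℤ w ≡ fromℤ (z - w)
fromℤ-minus z w = trans (cong (fromℤ z ℚ.+_) (fromℤ-neg w)) (fromℤ-+ z (- w))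

fromℤ-mono-≤ : ∀ {z w} → z ℤ.≤ w → fromℤ z ℚ.≤ fromℤ w
fromℤ-mono-≤ {z} {w} z≤w = ℚ.toℚᵘ-cancel-≤ (ℚᵘ.≤-respˡ-≃ (ℚᵘ.≃-sym (toℚᵘ-fromℤ z))
  (ℚᵘ.≤-respʳ-≃ (ℚᵘ.≃-sym (toℚᵘ-fromℤ w))
    (ℚᵘ.*≤* (subst₂ ℤ._≤_ (sym (ℤ.*-identityʳ z)) (sym (ℤ.*-identityʳ w)) z≤w))))

fromℤ-injective : ∀ z w → fromℤ z ≡ fromℤ w → z ≡ w
fromℤ-injective z w eq = ℤ.≤-antisym (fromℤ-cancel-≤ {z} {w} (ℚ.≤-reflexive eq)) (fromℤ-cancel-≤ {w} {z} (ℚ.≤-reflexive (sym eq)))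

coordinateSum-* : ∀ c {n} (y : Vec ℚ n) → coordinateSum (map (c ℚ.*_) y) ≡ c ℚ.* coordinateSum y
coordinateSum-* c []      = sym (ℚ.*-zeroʳ c)
coordinateSum-* c (q ∷ y) = trans (cong (c ℚ.* q ℚ.+_) (coordinateSum-* c y)) (sym (ℚ.*-distribˡ-+ c q (coordinateSum y)))

coordinateSum-fromℤ : ∀ {n} (xs : Vec ℕ n) → coordinateSum (map fromℤ (map +_ xs)) ≡ fromℤ (+ Vec.sum xs)
coordinateSum-fromℤ []       = refl
coordinateSum-fromℤ (x ∷ xs) = trans (cong (fromℕ x ℚ.+_) (coordinateSum-fromℤ xs)) (fromℤ-+ (+ x) (+ Vec.sum xs))

-‿≤⇒+-≤ : ∀ x y b c → + x - + y ℤ.≤ + b - + c → c ℕ.+ x ℕ.≤ b ℕ.+ y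
-‿≤⇒+-≤ x y b c p = ℤ.drop‿+≤+ (subst₂ ℤ._≤_ (e₁ (+ x) (+ y) (+ c)) (e₂ (+ b) (+ c) (+ y)) (ℤ.+-monoˡ-≤ (+ c + + y) p))
  where
  e₁ : ∀ x y c → (x - y) + (c + y) ≡ c + x
  e₁ = solve-∀
  e₂ : ∀ b c y → (b - c) + (c + y) ≡ b + y
  e₂ = solve-∀

+-≤⇒-‿≤ : ∀ x y b c → c ℕ.+ x ℕ.≤ b ℕ.+ y → + x - + y ℤ.≤ + b - + c
+-≤⇒-‿≤ x y b c p = subst₂ ℤ._≤_ (e₁ (+ x) (+ y) (+ c)) (e₂ (+ b) (+ c) (+ y)) (ℤ.+-monoˡ-≤ (- (+ c + + y)) (+≤+ p))
  where
  e₁ : ∀ x y c → (c + x) + - (c + y) ≡ x - y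
  e₁ = solve-∀
  e₂ : ∀ b c y → (b + y) + - (c + y) ≡ b - c
  e₂ = solve-∀

-- From dilated rational sections to integer inequalities

module Dilation (k : ℕ) .{{_ : NonZero k}} where

  κ : ℚ
  κ = fromℕ k

  private instance
    κ-pos : ℚ.Positive κ
    κ-pos = fromℕ-pos k

    κ-nonNeg : ℚ.NonNegative κ
    κ-nonNeg = ℚ.pos⇒nonNeg κ

  κ-cancel : ∀ {p q} → κ ℚ.* p ≡ κ ℚ.* q → p ≡ q
  κ-cancel eq = ℚ.≤-antisym (ℚ.*-cancelˡ-≤-pos κ (ℚ.≤-reflexive eq)) (ℚ.*-cancelˡ-≤-pos κ (ℚ.≤-reflexive (sym eq)))

  κ-fromℕ : ∀ m → κ ℚ.* fromℕ m ≡ fromℕ (k ℕ.* m)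
  κ-fromℕ m = trans (fromℤ-* (+ k) (+ m)) (cong fromℤ (sym (ℤ.pos-* k m)))

  κ-minus : ∀ {p q} x y → κ ℚ.* p ≡ fromℕ x → κ ℚ.* q ≡ fromℕ y → κ ℚ.* (p ℚ.- q) ≡ fromℤ (+ x - + y)
  κ-minus {p} {q} x y p≡ q≡ = trans (ℚ.*-distribˡ-+ κ p (ℚ.- q))
    (trans (cong₂ ℚ._+_ p≡ (trans (sym (ℚ.neg-distribʳ-* κ q)) (cong ℚ.-_ q≡))) (fromℤ-minus (+ x) (+ y)))

  -- The cyclic and sum conditions multiplied by k; the bounds on single coordinates come from the
  -- box being summed over. The level `w` is an integer because n - t may be negative.
  CLLattice : ∀ {s} → Vec ℕ s → ℕ → ℤ → Vec ℕ s → Set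
  CLLattice a l w xs =
    (∀ i → k ℕ.* l ℕ.+ lookup xs i ℕ.≤ lookup (map (k ℕ.*_) a) i ℕ.+ lookup (rotate xs) i) ×
    + Vec.sum xs ≡ + k * w

  module _ {s} (a : Vec ℕ s) (l : ℕ) (w : ℤ) (xs : Vec ℕ s) where

    Points : Set
    Points = latticePoints (dilate k (CLSection a l (fromℤ w))) (map +_ xs)

    module _ {y : Vec ℚ s} (eq : map (κ ℚ.*_) y ≡ map fromℤ (map +_ xs)) where

      κ-lookup : ∀ i → κ ℚ.* lookup y i ≡ fromℕ (lookup xs i)
      κ-lookup i = trans (sym (lookup-map i _ y)) (trans (cong (λ v → lookup v i) eq)
        (trans (lookup-map i fromℤ (map +_ xs)) (cong fromℤ (lookup-map i +_ xs))))

      κ-difference : ∀ i → κ ℚ.* (lookup y i ℚ.- lookup y (next i)) ≡ fromℤ (+ lookup xs i - + lookup (rotate xs) i)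
      κ-difference i = κ-minus (lookup xs i) (lookup (rotate xs) i) (κ-lookup i)
        (trans (κ-lookup (next i)) (cong fromℕ (lookup-next xs i)))

      κ-bound : ∀ i → κ ℚ.* (fromℕ (lookup a i) ℚ.- fromℕ l) ≡ fromℤ (+ lookup (map (k ℕ.*_) a) i - + (k ℕ.* l))
      κ-bound i = κ-minus (lookup (map (k ℕ.*_) a) i) (k ℕ.* l)
        (trans (κ-fromℕ (lookup a i)) (cong fromℕ (sym (lookup-map i (k ℕ.*_) a)))) (κ-fromℕ l)

      κ-sum : κ ℚ.* coordinateSum y ≡ fromℤ (+ Vec.sum xs)
      κ-sum = trans (sym (coordinateSum-* κ y)) (trans (cong coordinateSum eq) (coordinateSum-fromℤ xs))

    points⇒lattice : Points → CLLattice a l w xs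
    points⇒lattice (y , (cl , sum≡) , eq) =
        (λ i → -‿≤⇒+-≤ (lookup xs i) (lookup (rotate xs) i) (lookup (map (k ℕ.*_) a) i) (k ℕ.* l) (fromℤ-cancel-≤
          {+ lookup xs i - + lookup (rotate xs) i} {+ lookup (map (k ℕ.*_) a) i - + (k ℕ.* l)}
          (subst₂ ℚ._≤_ (κ-difference eq i) (κ-bound eq i)
          (ℚ.*-monoˡ-≤-nonNeg κ (proj₂ (cl i))))))
      , fromℤ-injective (+ Vec.sum xs) (+ k * w) (trans (sym (κ-sum eq)) (trans (cong (κ ℚ.*_) sum≡) (fromℤ-* (+ k) w)))

    lattice⇒points : Pointwise ℕ._≤_ xs (map (k ℕ.*_) a) → CLLattice a l w xs → Points
    lattice⇒points xs≤ka (edges , sum≡) = y , (cl , sum-y) , eq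
      where
      y : Vec ℚ s
      y = unscale k (map fromℤ (map +_ xs))

      eq : map (κ ℚ.*_) y ≡ map fromℤ (map +_ xs)
      eq = scale-unscale k (map fromℤ (map +_ xs))

      cl : CL a l y
      cl i =
          ( ℚ.*-cancelˡ-≤-pos κ (subst₂ ℚ._≤_ (sym (ℚ.*-zeroʳ κ)) (sym (κ-lookup eq i))
              (fromℤ-mono-≤ {0ℤ} {+ lookup xs i} (+≤+ z≤n)))
          , ℚ.*-cancelˡ-≤-pos κ (subst₂ ℚ._≤_ (sym (κ-lookup eq i)) (sym (κ-fromℕ (lookup a i)))
              (fromℤ-mono-≤ (+≤+ (subst (lookup xs i ℕ.≤_) (lookup-map i (k ℕ.*_) a) (Pointwise.lookup xs≤ka i))))))
        , ℚ.*-cancelˡ-≤-pos κ (subst₂ ℚ._≤_ (sym (κ-difference eq i)) (sym (κ-bound eq i))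
              (fromℤ-mono-≤ (+-≤⇒-‿≤ (lookup xs i) (lookup (rotate xs) i) (lookup (map (k ℕ.*_) a) i) (k ℕ.* l) (edges i))))

      sum-y : coordinateSum y ≡ fromℤ w
      sum-y = κ-cancel (trans (κ-sum eq) (trans (cong fromℤ sum≡) (sym (fromℤ-* (+ k) w))))

  -- Kept general in `e` and `T` to serve both sections: the two hypotheses say that, within the
  -- box, lying over level `w` amounts to having degree `T`.
  Ehr≡count : ∀ {s} (a : Vec ℕ s) l w e T →
    (∀ xs → Pointwise ℕ._≤_ xs (map (k ℕ.*_) a) → + Vec.sum xs ≡ + k * w → degree e (map (k ℕ.*_) a) xs ≡ T) →
    (∀ xs → Pointwise ℕ._≤_ xs (map (k ℕ.*_) a) → degree e (map (k ℕ.*_) a) xs ≡ T → + Vec.sum xs ≡ + k * w) →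
    + Ehr (CLSection a l (fromℤ w)) (CLSection-latticeFinite a l (fromℤ w)) k ≡
    Counting.count (k ℕ.* l) e (map (k ℕ.*_) a) T
  Ehr≡count a l w e T to from = trans (length-filter-box Q? k a) (boxSum-cong (map (k ℕ.*_) a) λ xs xs≤ka →
    let edges?  = Fin.all? (λ i → k ℕ.* l ℕ.+ lookup xs i ℕ.≤? lookup (map (k ℕ.*_) a) i ℕ.+ lookup (rotate xs) i)
        degree? = degree e (map (k ℕ.*_) a) xs ℕ.≟ T
    in begin
    ⟦ Q? (map +_ xs) ⟧
      ≡⟨ ⟦⟧-cong (Q? (map +_ xs)) (edges? ×-dec degree?)
           (λ p → let c , d = points⇒lattice a l w xs p in c , to xs xs≤ka d)
           (λ (c , d) → lattice⇒points a l w xs xs≤ka (c , from xs xs≤ka d)) ⟩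
    ⟦ edges? ×-dec degree? ⟧
      ≡⟨ ⟦⟧-× edges? degree? ⟨
    ⟦ edges? ⟧ * ⟦ degree? ⟧
      ≡⟨ cong (_* ⟦ degree? ⟧) (edgeProduct-⟦⟧ (k ℕ.* l) (map (k ℕ.*_) a) xs (rotate xs) edges?) ⟨
    Cycle.edgeProduct (k ℕ.* l) (map (k ℕ.*_) a) xs (rotate xs) * ⟦ degree? ⟧ ∎)
    where
    -- The very decision procedure inside `CLSection-latticeFinite`, so that the enumerated list is
    -- definitionally `filter Q? (box k a)`.
    Q? : Decidable (latticePoints (dilate k (CLSection a l (fromℤ w))))
    Q? z = dilate? k (CLSection? a l (fromℤ w)) (map fromℤ z)

-- Complementary degrees and the conclusion

degree-coordinate : ∀ {n} (bs xs : Vec ℕ n) → degree coordinate bs xs ≡ Vec.sum xs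
degree-coordinate []       []       = refl
degree-coordinate (b ∷ bs) (x ∷ xs) = cong (x ℕ.+_) (degree-coordinate bs xs)

degree-cocoordinate : ∀ {n} {bs xs : Vec ℕ n} → Pointwise ℕ._≤_ xs bs →
  + degree cocoordinate bs xs ≡ + Vec.sum bs - + Vec.sum xs
degree-cocoordinate [] = refl
degree-cocoordinate {bs = b ∷ bs} {x ∷ xs} (x≤b ∷ xs≤bs) = trans
  (cong₂ _+_ (trans (sym (ℤ.⊖-≥ x≤b)) (sym (ℤ.m-n≡m⊖n b x))) (degree-cocoordinate xs≤bs))
  (eq (+ b) (+ x) (+ Vec.sum bs) (+ Vec.sum xs))
  where
  eq : ∀ b x s t → (b - x) + (s - t) ≡ (b + s) - (x + t)
  eq = solve-∀

sum-map-* : ∀ k {n} (a : Vec ℕ n) → Vec.sum (map (k ℕ.*_) a) ≡ k ℕ.* Vec.sum a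
sum-map-* k []      = sym (ℕ.*-zeroʳ k)
sum-map-* k (b ∷ a) = trans (cong (k ℕ.* b ℕ.+_) (sum-map-* k a)) (sym (ℕ.*-distribˡ-+ k b (Vec.sum a)))

theorem1 : ∀ {s n : ℕ} (a : Vec ℕ s) → IsComposition n a →
    ∀ (l : ℕ) → (∀ i → 2 ℕ.* l ℕ.≤ lookup a i) →
    ∀ (t : ℕ) → 0 ℕ.< t →
    ∀ (k : ℕ) .{{_ : NonZero k}} →
    Ehr (CLSection a l (fromℕ t)) (CLSection-latticeFinite a l (fromℕ t)) k
    ≡ Ehr (CLSection a l (fromℕ n ℚ.- fromℕ t)) (CLSection-latticeFinite a l (fromℕ n ℚ.- fromℕ t)) k
theorem1 {n = n} a (_ , sum≡n) l 2l≤a t _ k = ℤ.+-injective (begin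
  + Ehr (CLSection a l (fromℕ t)) (CLSection-latticeFinite a l (fromℕ t)) k
    ≡⟨ Ehr≡count a l (+ t) coordinate (k ℕ.* t)
         (λ xs _ d → trans (degree-coordinate ka xs) (ℤ.+-injective (trans d (sym (ℤ.pos-* k t)))))
         (λ xs _ d → trans (cong +_ (trans (sym (degree-coordinate ka xs)) d)) (ℤ.pos-* k t)) ⟩
  count coordinate ka (k ℕ.* t)
    ≡⟨ count-symmetric large (k ℕ.* t) ⟩
  count cocoordinate ka (k ℕ.* t)
    -- The bounds k a sum to k n, so codegree k t means coordinate sum k (n - t). The computation is
    -- in the integers and also covers t > n.
    ≡⟨ Ehr≡count a l (+ n - + t) cocoordinate (k ℕ.* t)
         (λ xs xs≤ka d → ℤ.+-injective (trans (codegree xs≤ka) (trans (cong (λ i → + k * + n - i) d)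
           (trans (e₁ (+ k) (+ n) (+ t)) (sym (ℤ.pos-* k t))))))
         (λ xs xs≤ka d → trans (e₂ (+ k * + n) (+ Vec.sum xs)) (trans (cong (_-_ (+ k * + n)) (trans (sym (codegree xs≤ka))
           (trans (cong +_ d) (ℤ.pos-* k t)))) (e₃ (+ k) (+ n) (+ t)))) ⟨
  + Ehr (CLSection a l (fromℤ (+ n - + t))) (CLSection-latticeFinite a l (fromℤ (+ n - + t))) k
    ≡⟨ cong (λ τ → + Ehr (CLSection a l τ) (CLSection-latticeFinite a l τ) k) (fromℤ-minus (+ n) (+ t)) ⟨
  + Ehr (CLSection a l (fromℕ n ℚ.- fromℕ t)) (CLSection-latticeFinite a l (fromℕ n ℚ.- fromℕ t)) k ∎)
  where
  open Dilation k
  open Counting (k ℕ.* l)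
  open Cycle (k ℕ.* l) using (Large)

  ka = map (k ℕ.*_) a

  e₁ : ∀ k n t → k * n - k * (n - t) ≡ k * t
  e₁ = solve-∀
  e₂ : ∀ i j → j ≡ i - (i - j)
  e₂ = solve-∀
  e₃ : ∀ k n t → k * n - k * t ≡ k * (n - t)
  e₃ = solve-∀

  codegree : ∀ {xs} → Pointwise ℕ._≤_ xs ka → + degree cocoordinate ka xs ≡ + k * + n - + Vec.sum xs
  codegree {xs} xs≤ka = trans (degree-cocoordinate xs≤ka) (cong (_- + Vec.sum xs)
    (trans (cong +_ (trans (sum-map-* k a) (cong (k ℕ.*_) sum≡n))) (ℤ.pos-* k n)))

  -- Dilation preserves the hypothesis: 2 l ≤ aᵢ gives 2 (k l) ≤ k aᵢ.
  large : All Large ka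
  large = All.map⁺ (All.lookup⁻ λ i → subst (ℕ._≤ k ℕ.* lookup a i)
    (trans (sym (ℕ.*-assoc k 2 l)) (trans (cong (ℕ._* l) (ℕ.*-comm k 2)) (ℕ.*-assoc 2 k l)))
    (ℕ.*-monoʳ-≤ k (2l≤a i)))
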